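{- Let $n\ge2$. Then (a) $P_n(0,0)=0$; (b) $P_n(1,0)=1$; (c) $2\mid P_n(0,1)$ if and only if $n=2^m$ for some $m\ge1$; (d) $2\mid P_n(1,1)$ if and only if $n=3\cdot2^m$ for some $m\ge0$.
   Context: Let $\Phi_n(q)$ be the $n$th cyclotomic polynomial and $\phi$ the Euler totient function. For $n\ge 2$, $\Phi_n(q)$ is palindromic of degree $\phi(n)$ with constant term $1$, so there are unique complex numbers $\gamma_j$ with $\Phi_n(q)=\sum_{0\le j\le \phi(n)/2}\gamma_j q^j(1+q)^{\phi(n)-2j}$; the $n$th Lucas atom is $P_n(s,t)=\sum_j \gamma_j s^{\phi(n)-2j}(-t)^j$ (a polynomial with integer coefficients). -}

module Defs where

open import Data.Nat as ℕ using (ℕ; zero; suc; _∸_; _≟_)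
open import Data.Nat.Divisibility using (_∣?_)
open import Data.Nat.GCD using (gcd)
open import Data.Integer as ℤ using (ℤ; +_; -_)
open import Data.List using (List; []; _∷_; map; foldr; reverse; length; filter; drop; upTo)
open import Relation.Nullary.Decidable using (⌊_⌋)
open import Data.Bool using (if_then_else_)
open import Relation.Binary.PropositionalEquality using (_≡_)

-- Polynomials over ℤ in one variable q, as coefficient lists
-- (lowest degree first).  Two polynomials are equal iff all their
-- coefficients agree (trailing zeros irrelevant).

Poly : Set
Poly = List ℤ

coeff : Poly → ℕ → ℤ
coeff []       _       = + 0
coeff (x ∷ xs) zero    = x
coeff (x ∷ xs) (suc k) = coeff xs k

_≈ₚ_ : Poly → Poly → Set
p ≈ₚ r = ∀ k → coeff p k ≡ coeff r k

addP : Poly → Poly → Poly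
addP []       ys       = ys
addP (x ∷ xs) []       = x ∷ xs
addP (x ∷ xs) (y ∷ ys) = (x ℤ.+ y) ∷ addP xs ys

scaleP : ℤ → Poly → Poly
scaleP c = map (c ℤ.*_)

mulP : Poly → Poly → Poly
mulP []       ys = []
mulP (x ∷ xs) ys = addP (scaleP x ys) (+ 0 ∷ mulP xs ys)

oneP : Poly
oneP = + 1 ∷ []

powP : Poly → ℕ → Poly
powP p zero    = oneP
powP p (suc k) = mulP p (powP p k)

prodP : List Poly → Poly
prodP = foldr mulP oneP

sumP : List Poly → Poly
sumP = foldr addP []

qP : Poly
qP = + 0 ∷ + 1 ∷ []

onePlusQ : Poly
onePlusQ = + 1 ∷ + 1 ∷ []

qPowMinusOne : ℕ → Poly
qPowMinusOne n = addP (powP qP n) (- (+ 1) ∷ [])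

-- Exact division by a monic polynomial (long division).
-- Lists here are highest degree first; the divisor is 1 ∷ gt.

private
  subPrefix : List ℤ → List ℤ → List ℤ
  subPrefix xs       []       = xs
  subPrefix []       (y ∷ ys) = (- y) ∷ subPrefix [] ys
  subPrefix (x ∷ xs) (y ∷ ys) = (x ℤ.- y) ∷ subPrefix xs ys

  qdiv : ℕ → List ℤ → List ℤ → List ℤ
  qdiv zero    f       gt = []
  qdiv (suc k) []      gt = []
  qdiv (suc k) (c ∷ f) gt = c ∷ qdiv k (subPrefix f (scaleP c gt)) gt

-- quotient of f by the monic polynomial g (g given with its leading 1
-- as last entry); used only for exact divisions
divMonic : Poly → Poly → Poly
divMonic f g = reverse (qdiv (length f ∸ length gt) (reverse f) gt)
  where gt = drop 1 (reverse g)

-- Cyclotomic polynomials, via  q^n - 1 = ∏_{d ∣ n} Φ_d(q)  (n ≥ 1),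
-- i.e.  Φ_n = (q^n - 1) / ∏_{d ∣ n, d < n} Φ_d.

properDivisors : ℕ → List ℕ
properDivisors m = filter (λ d → d ∣? m) (drop 1 (upTo m))

-- cycTable n k = Φ_k for 1 ≤ k ≤ n
cycTable : ℕ → ℕ → Poly
cycTable zero    k = oneP
cycTable (suc n) k =
  if ⌊ k ≟ suc n ⌋
  then divMonic (qPowMinusOne (suc n)) (prodP (map (cycTable n) (properDivisors (suc n))))
  else cycTable n k

cyclotomic : ℕ → Poly
cyclotomic n = cycTable n n

totient : ℕ → ℕ
totient n = length (filter (λ k → gcd k n ≟ 1) (map suc (upTo n)))

lucasExpansion : ℕ → (ℕ → ℤ) → Poly
lucasExpansion n γ =
  sumP (map (λ j → scaleP (γ j) (mulP (powP qP j) (powP onePlusQ (totient n ∸ 2 ℕ.* j))))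
            (upTo (ℕ._/_ (totient n) 2 ℕ.+ 1)))

IsLucasCoefficients : ℕ → (ℕ → ℤ) → Set
IsLucasCoefficients n γ = cyclotomic n ≈ₚ lucasExpansion n γ

lucasAtom : ℕ → (ℕ → ℤ) → ℤ → ℤ → ℤ
lucasAtom n γ s t =
  foldr ℤ._+_ (+ 0)
    (map (λ j → γ j ℤ.* (s ℤ.^ (totient n ∸ 2 ℕ.* j)) ℤ.* ((- t) ℤ.^ j))
         (upTo (ℕ._/_ (totient n) 2 ℕ.+ 1)))

{-# OPTIONS --safe #-}

-- The polynomials Φ n are pairwise coprime up to a non-zero integer: for g = gcd d e < e
-- the quotient (q^e - 1) / (q^g - 1) is a multiple of Φ e and is e/g modulo q^g - 1, which
-- lies in the ideal of Φ d and Φ e.  As they have constant coefficient ±1, Gauss's lemma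
-- makes the product of Φ d over the proper divisors d of n divide q^n - 1 over ℤ, so the
-- division defining Φ n is exact.
-- Modulo 2, P n (0, 1) is Φ n (1), and P n (1, 1) is Φ n (ω) up to a unit, for ω ∈ 𝔽₄ of
-- order 3.  Let ζ ∈ 𝔽₄ have order r.  If Φ n (ζ) = 0 then ζ^n = 1, so n = g k with
-- g = r 2^a and k odd; if k > 1, then Φ n divides (q^n - 1) / (q^g - 1), whose value at ζ
-- is k ≠ 0.  Conversely for n = r 2^(a+1) and g = n/2 that quotient vanishes at ζ, and it is
-- the product of Φ n with factors Φ i where i is not of the form r 2^b.
module Submission where

open import Defs
open import Algebra.Bundles using (CommutativeRing)
open import Algebra.Structures using (IsCommutativeRing)
open import Data.Bool using (Bool; true; false; if_then_else_; _∧_; not)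
open import Data.Bool.Properties using (∧-zeroʳ)
open import Data.Integer as ℤ using (ℤ; +_)
open import Data.Integer.Divisibility.Signed as ℤ∣ using (divides) renaming (_∣_ to _∣ᶻ_)
import Data.Integer.Properties as ℤ
open import Data.Integer.Tactic.RingSolver using (solve-∀)
open import Data.List as List using (List; []; _∷_; _++_; _∷ʳ_; length; reverse; drop; foldl)
import Data.List.Properties as List
open import Data.List.Relation.Unary.All as All using (All; []; _∷_)
open import Data.List.Relation.Unary.All.Properties using (all-upTo)
open import Data.Nat as ℕ using (ℕ; zero; suc; _≤_; _<_; z≤n; s≤s; _∸_)
open import Data.Nat.Divisibility as ℕ∣ using (_∣?_) renaming (_∣_ to _∣ⁿ_; _∤_ to _∤ⁿ_)
open import Data.Nat.DivMod using (m/n*n≤m)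
open import Data.Nat.GCD using (gcd; gcd-GCD; gcd-zeroˡ; module Bézout; gcd[m,n]∣m; gcd[m,n]∣n)
open import Data.Nat.Induction using (<-rec)
import Data.Nat.Properties as ℕ
open import Data.Parity as ℙ using (Parity; 0ℙ; 1ℙ)
import Data.Parity.Properties as ℙ
open import Data.Product using (_×_; _,_; ∃; ∃₂; proj₁; proj₂)
open import Data.Product.Properties using (≡-dec)
open import Data.Sum using (inj₁; inj₂; _⊎_; [_,_]′)
open import Function.Base using (it; id)
open import Function.Bundles using (_⇔_; mk⇔; Equivalence)
open import Level using (0ℓ)
open import Relation.Binary.PropositionalEquality as ≡
  using (_≡_; _≢_; refl; sym; trans; cong; cong₂; subst; subst₂; module ≡-Reasoning)
import Relation.Binary.Reasoning.Setoid as SetoidReasoning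
open import Relation.Nullary using (contradiction; does; yes; no; ¬_; Dec)
open import Relation.Nullary.Decidable using (dec-true; dec-false; from-yes; map′; _×-dec_; _⊎-dec_; _→-dec_)

-- Dividing the expansion by (1 + q)^φ gives Φ n (q) = (1 + q)^φ Σ γ_j (q / (1 + q)²)^j, while P n
-- (1, t) = Σ γ_j (-t)^j. So P n (1, t) is read off at a ζ with ζ / (1 + ζ)² = -t. For t = 1 modulo
-- 2 this is ζ² + ζ + 1 = 0, which has no root in 𝔽₂ and dictates 𝔽₄; for t = 0 it is ζ = 0, already
-- over ℤ, so part (b) is the constant coefficient of Φ n. For s = 0 one takes 1 + ζ = 0, which is ζ
-- = 1 modulo 2. Part (a) rests on φ(n) > 0. The obstacle is that `cyclotomic` is the output of a
-- division algorithm and satisfies no known identity until the division is known to be exact.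
-- Exactness at n in turn rests on the factorizations of q^d - 1 for all d < n, so the algebra of
-- the Φ d is developed with these factorizations as hypotheses. Everything stays inside ℤ[q],
-- without complex roots or fractions, which is why integers have to be cancelled from ideal
-- relations.

-- Geometric sums and two-generator ideals in a commutative ring.

module Geometric {c ℓ} (R : CommutativeRing c ℓ) where
  open CommutativeRing R renaming (refl to ≈-refl; sym to ≈-sym; trans to ≈-trans)
  open import Algebra.Properties.Semiring.Exp semiring
  open import Algebra.Properties.Semiring.Mult semiring renaming (_×_ to _×ᴹ_)
  open import Algebra.Properties.Ring ring
  open import Algebra.Solver.Ring.NaturalCoefficients.Default commutativeSemiring
    using (solve; _:+_; _:*_; _:=_; con)
  open SetoidReasoning setoid

  infix 4 _∈⟨_,_⟩

  -- Membership in the ideal generated by a and b, with the two cofactors kept as data.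
  _∈⟨_,_⟩ : Carrier → Carrier → Carrier → Set _
  z ∈⟨ a , b ⟩ = ∃₂ λ u v → u * a + v * b ≈ z

  ∈-resp : ∀ {a b z w} → z ≈ w → z ∈⟨ a , b ⟩ → w ∈⟨ a , b ⟩
  ∈-resp e (u , v , p) = u , v , ≈-trans p e

  ∈-genˡ : ∀ {a b} s → s * a ∈⟨ a , b ⟩
  ∈-genˡ {a} {b} s = s , 0# , ≈-trans (+-congˡ (zeroˡ b)) (+-identityʳ _)

  ∈-genʳ : ∀ {a b} s → s * b ∈⟨ a , b ⟩
  ∈-genʳ {a} {b} s = 0# , s , ≈-trans (+-congʳ (zeroˡ a)) (+-identityˡ _)

  ∈-+ : ∀ {a b z w} → z ∈⟨ a , b ⟩ → w ∈⟨ a , b ⟩ → z + w ∈⟨ a , b ⟩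
  ∈-+ {a} {b} (u , v , p) (u′ , v′ , p′) =
    u + u′ , v + v′ , ≈-trans (rearrange a b u v u′ v′) (+-cong p p′)
    where
    rearrange : ∀ a b u v u′ v′ → (u + u′) * a + (v + v′) * b ≈ (u * a + v * b) + (u′ * a + v′ * b)
    rearrange = solve 6 (λ a b u v u′ v′ →
      (u :+ u′) :* a :+ (v :+ v′) :* b := (u :* a :+ v :* b) :+ (u′ :* a :+ v′ :* b)) ≈-refl

  ∈-* : ∀ {a b z} s → z ∈⟨ a , b ⟩ → s * z ∈⟨ a , b ⟩
  ∈-* {a} {b} s (u , v , p) = s * u , s * v , ≈-trans (rearrange a b s u v) (*-congˡ p)
    where
    rearrange : ∀ a b s u v → s * u * a + s * v * b ≈ s * (u * a + v * b)
    rearrange = solve 5 (λ a b s u v →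
      s :* u :* a :+ s :* v :* b := s :* (u :* a :+ v :* b)) ≈-refl

  ∈-cancel : ∀ {a b z w} → z + w ∈⟨ a , b ⟩ → w ∈⟨ a , b ⟩ → z ∈⟨ a , b ⟩
  ∈-cancel {z = z} {w} p q = ∈-resp (begin
    (z + w) + - 1# * w  ≈⟨ +-congˡ (-1*x≈-x w) ⟩
    (z + w) + - w       ≈⟨ +-assoc z w (- w) ⟩
    z + (w + - w)       ≈⟨ +-congˡ (-‿inverseʳ w) ⟩
    z + 0#              ≈⟨ +-identityʳ z ⟩
    z                   ∎) (∈-+ p (∈-* (- 1#) q))

  ∈-trans : ∀ {a b a′ b′ z} → z ∈⟨ a , b ⟩ → a ∈⟨ a′ , b′ ⟩ → b ∈⟨ a′ , b′ ⟩ → z ∈⟨ a′ , b′ ⟩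
  ∈-trans (u , v , p) q r = ∈-resp p (∈-+ (∈-* u q) (∈-* v r))

  -- Multiply the two combinations: every term other than u u′ a a′ carries a factor b.
  ∈-product : ∀ {a a′ b m n} → m ×ᴹ 1# ∈⟨ a , b ⟩ → n ×ᴹ 1# ∈⟨ a′ , b ⟩ →
    (m ℕ.* n) ×ᴹ 1# ∈⟨ a * a′ , b ⟩
  ∈-product {a} {a′} {b} {m} {n} (u , v , p) (u′ , v′ , p′) =
    u * u′ , u * a * v′ + u′ * a′ * v + v * v′ * b ,
    ≈-trans (expand a a′ b u v u′ v′) (≈-trans (*-cong p p′) (≈-sym (×1-homo-* m n)))
    where
    expand : ∀ a a′ b u v u′ v′ →
      u * u′ * (a * a′) + (u * a * v′ + u′ * a′ * v + v * v′ * b) * b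
        ≈ (u * a + v * b) * (u′ * a′ + v′ * b)
    expand = solve 7 (λ a a′ b u v u′ v′ →
      u :* u′ :* (a :* a′) :+ (u :* a :* v′ :+ u′ :* a′ :* v :+ v :* v′ :* b) :* b := (u :* a :+ v :* b) :* (u′ :* a′ :+ v′ :* b)) ≈-refl

  module _ (x : Carrier) where

    X : ℕ → Carrier
    X n = x ^ n + - 1#

    ^≈1+X : ∀ n → x ^ n ≈ 1# + X n
    ^≈1+X n = ≈-sym (begin
      1# + (x ^ n + - 1#)    ≈⟨ +-congˡ (+-comm (x ^ n) (- 1#)) ⟩
      1# + (- 1# + x ^ n)    ≈⟨ +-assoc 1# (- 1#) (x ^ n) ⟨
      (1# + - 1#) + x ^ n    ≈⟨ +-congʳ (-‿inverseʳ 1#) ⟩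
      0# + x ^ n             ≈⟨ +-identityˡ (x ^ n) ⟩
      x ^ n                  ∎)

    -- After adding 1 to both sides this is x^(m+n) = x^m x^n.
    X-+ : ∀ m n → X (m ℕ.+ n) ≈ X m + x ^ m * X n
    X-+ m n = +-cancelˡ 1# _ _ (begin
      1# + X (m ℕ.+ n)             ≈⟨ ^≈1+X (m ℕ.+ n) ⟨
      x ^ (m ℕ.+ n)                ≈⟨ ^-homo-* x m n ⟩
      x ^ m * x ^ n                ≈⟨ *-congˡ (^≈1+X n) ⟩
      x ^ m * (1# + X n)           ≈⟨ distribˡ (x ^ m) 1# (X n) ⟩
      x ^ m * 1# + x ^ m * X n     ≈⟨ +-congʳ (≈-trans (*-identityʳ (x ^ m)) (^≈1+X m)) ⟩
      1# + X m + x ^ m * X n       ≈⟨ +-assoc 1# (X m) _ ⟩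
      1# + (X m + x ^ m * X n)     ∎)

    -- geom g k = 1 + x^g + ... + x^((k-1)g) = X (k g) / X g
    geom : ℕ → ℕ → Carrier
    geom g zero    = 0#
    geom g (suc k) = 1# + x ^ g * geom g k

    X-* : ∀ k g → X (k ℕ.* g) ≈ X g * geom g k
    X-* zero    g = ≈-trans (-‿inverseʳ 1#) (≈-sym (zeroʳ (X g)))
    X-* (suc k) g = begin
      X (g ℕ.+ k ℕ.* g)                  ≈⟨ X-+ g (k ℕ.* g) ⟩
      X g + x ^ g * X (k ℕ.* g)          ≈⟨ +-congˡ (*-congˡ (X-* k g)) ⟩
      X g + x ^ g * (X g * geom g k)     ≈⟨ rearrange (X g) (x ^ g) (geom g k) ⟩
      X g * (1# + x ^ g * geom g k)      ∎
      where
      rearrange : ∀ a b s → a + b * (a * s) ≈ a * (1# + b * s)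
      rearrange = solve 3 (λ a b s →
        a :+ b :* (a :* s) := a :* (con 1 :+ b :* s)) ≈-refl

    -- The sum of `geom g i` over i < k. It is the cofactor of `X g` in `geom g k` - k, because each
    -- x^(i g) - 1 is `X g` times `geom g i`.
    geomQuotient : ℕ → ℕ → Carrier
    geomQuotient g zero    = 0#
    geomQuotient g (suc k) = geomQuotient g k + geom g k

    geom≈ : ∀ g k → geom g k ≈ k ×ᴹ 1# + X g * geomQuotient g k
    geom≈ g zero    = ≈-sym (≈-trans (+-identityˡ _) (zeroʳ (X g)))
    geom≈ g (suc k) = begin
      1# + x ^ g * geom g k
        ≈⟨ +-congˡ (*-congʳ (^≈1+X g)) ⟩
      1# + (1# + X g) * geom g k
        ≈⟨ expand (X g) (geom g k) ⟩
      1# + (geom g k + X g * geom g k)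
        ≈⟨ +-congˡ (+-congʳ (geom≈ g k)) ⟩
      1# + ((k ×ᴹ 1# + X g * geomQuotient g k) + X g * geom g k)
        ≈⟨ collect 1# (k ×ᴹ 1#) (X g) (geomQuotient g k) (geom g k) ⟩
      (1# + k ×ᴹ 1#) + X g * (geomQuotient g k + geom g k) ∎
      where
      expand : ∀ a s → 1# + (1# + a) * s ≈ 1# + (s + a * s)
      expand = solve 2 (λ a s →
        con 1 :+ (con 1 :+ a) :* s := con 1 :+ (s :+ a :* s)) ≈-refl

      collect : ∀ o n a t s → o + ((n + a * t) + a * s) ≈ (o + n) + a * (t + s)
      collect = solve 5 (λ o n a t s →
        o :+ ((n :+ a :* t) :+ a :* s) := (o :+ n) :+ a :* (t :+ s)) ≈-refl

    -- In x^(m d) - 1 = (x^g - 1) + x^g (x^(n e) - 1) the left side is a multiple of `X d` and the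
    -- last term one of `X e`. The hypothesis is Bézout's identity freed of subtraction.
    X-bezout : ∀ {g d e} m n → g ℕ.+ n ℕ.* e ≡ m ℕ.* d → X g ∈⟨ X d , X e ⟩
    X-bezout {g} {d} {e} m n eq = ∈-cancel
      (∈-resp (≈-trans (*-comm (geom d m) (X d)) (≈-trans (≈-sym (X-* m d))
          (≈-trans (reflexive (cong X (sym eq))) (X-+ g (n ℕ.* e)))))
        (∈-genˡ (geom d m)))
      (∈-resp (≈-trans (*-assoc (x ^ g) (geom e n) (X e))
          (*-congˡ (≈-trans (*-comm (geom e n) (X e)) (≈-sym (X-* n e)))))
        (∈-genʳ (x ^ g * geom e n)))

    ∈-swap : ∀ {a b z} → z ∈⟨ a , b ⟩ → z ∈⟨ b , a ⟩
    ∈-swap (u , v , p) = v , u , ≈-trans (+-comm _ _) p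

-- Ring identities for long division and for coprime divisors.

module Rearrangement {c ℓ} (R : CommutativeRing c ℓ) where
  open CommutativeRing R renaming (refl to ≈-refl)
  open import Algebra.Solver.Ring.NaturalCoefficients.Default commutativeSemiring
    using (solve; _:+_; _:*_; _:=_; con)

  rearrange₁ : ∀ x q p c a → x + q * (p + c * a) ≈ (x + q * p) + c * (q * a)
  rearrange₁ = solve 5 (λ x q p c a → x :+ q :* (p :+ c :* a) := x :+ q :* p :+ c :* (q :* a)) ≈-refl

  rearrange₂ : ∀ s a g c d b → (s + a * g) + (c + d) * (a * b) ≈ (s + c * (a * b)) + a * (g + d * b)
  rearrange₂ = solve 6 (λ s a g c d b → s :+ a :* g :+ (c :+ d) :* (a :* b)
    := s :+ c :* (a :* b) :+ a :* (g :+ d :* b)) ≈-refl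

  -- The bookkeeping of one division step: `1# * b` is the leading term of the monic divisor and g
  -- is the rest of it.
  rearrange₃ : ∀ G Q r a b c g →
    ((G * Q + r) + a * (c * g)) + c * (a * b) ≈ (G * Q + (c * a) * (g + 1# * b)) + r
  rearrange₃ = solve 7 (λ G Q r a b c g → G :* Q :+ r :+ a :* (c :* g) :+ c :* (a :* b)
    := G :* Q :+ (c :* a) :* (g :+ con 1 :* b) :+ r) ≈-refl

  collect : ∀ G Q d → G * Q + d * G ≈ G * (Q + d)
  collect = solve 3 (λ G Q d → G :* Q :+ d :* G := G :* (Q :+ d)) ≈-refl

module Cancellation {c ℓ} (R : CommutativeRing c ℓ) where
  open CommutativeRing R renaming (refl to ≈-refl; trans to ≈-trans)
  open import Algebra.Solver.Ring.NaturalCoefficients.Default commutativeSemiring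
    using (solve; _:+_; _:*_; _:=_)
  open SetoidReasoning setoid

  -- In m h = u a h + v b h, replace h by b l in the first term and by a k in the second.
  coprime-combination : ∀ {u v a b k l h m} → u * a + v * b ≈ m → a * k ≈ h → b * l ≈ h →
    (a * b) * (u * l + v * k) ≈ m * h
  coprime-combination {u} {v} {a} {b} {k} {l} {h} {m} e p r = begin
    (a * b) * (u * l + v * k)              ≈⟨ rearrange u v a b k l ⟩
    u * a * (b * l) + v * b * (a * k)      ≈⟨ +-cong (*-congˡ r) (*-congˡ p) ⟩
    u * a * h + v * b * h                  ≈⟨ distribʳ h (u * a) (v * b) ⟨
    (u * a + v * b) * h                    ≈⟨ *-congʳ e ⟩
    m * h                                  ∎
    where
    rearrange : ∀ u v a b k l → (a * b) * (u * l + v * k) ≈ u * a * (b * l) + v * b * (a * k)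
    rearrange = solve 6 (λ u v a b k l →
      (a :* b) :* (u :* l :+ v :* k) := u :* a :* (b :* l) :+ v :* b :* (a :* k)) ≈-refl

  swap-middle : ∀ a b c → a * (b * c) ≈ b * (a * c)
  swap-middle = solve 3 (λ a b c → a :* (b :* c) := b :* (a :* c)) ≈-refl

  interchange : ∀ a b c d → (a * b) * (c * d) ≈ (a * c) * (b * d)
  interchange = solve 4 (λ a b c d → (a :* b) :* (c :* d) := (a :* c) :* (b :* d)) ≈-refl

-- The commutative ring ℤ[q] of coefficient lists.

infix 4 _≋_

-- Wrapping _≈ₚ_ in a record lets Agda infer the polynomials from an equation.
record _≋_ (p r : Poly) : Set where
  constructor ⟨_⟩
  field
    at : p ≈ₚ r

open _≋_

negP : Poly → Poly
negP = List.map (λ x → ℤ.- x)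

coeff-addP : ∀ p r k → coeff (addP p r) k ≡ coeff p k ℤ.+ coeff r k
coeff-addP []       r        k       = sym (ℤ.+-identityˡ _)
coeff-addP (x ∷ p) []        zero    = sym (ℤ.+-identityʳ _)
coeff-addP (x ∷ p) []        (suc k) = sym (ℤ.+-identityʳ _)
coeff-addP (x ∷ p) (y ∷ r)   zero    = refl
coeff-addP (x ∷ p) (y ∷ r)   (suc k) = coeff-addP p r k

coeff-scaleP : ∀ c p k → coeff (scaleP c p) k ≡ c ℤ.* coeff p k
coeff-scaleP c []      k       = sym (ℤ.*-zeroʳ c)
coeff-scaleP c (x ∷ p) zero    = refl
coeff-scaleP c (x ∷ p) (suc k) = coeff-scaleP c p k

coeff-negP : ∀ p k → coeff (negP p) k ≡ ℤ.- coeff p k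
coeff-negP []      k       = refl
coeff-negP (x ∷ p) zero    = refl
coeff-negP (x ∷ p) (suc k) = coeff-negP p k

coeff-mulP-zero : ∀ p r → coeff (mulP p r) 0 ≡ coeff p 0 ℤ.* coeff r 0
coeff-mulP-zero []      r = sym (ℤ.*-zeroˡ (coeff r 0))
coeff-mulP-zero (x ∷ p) r = begin
  coeff (mulP (x ∷ p) r) 0        ≡⟨ coeff-addP (scaleP x r) _ 0 ⟩
  coeff (scaleP x r) 0 ℤ.+ + 0    ≡⟨ ℤ.+-identityʳ _ ⟩
  coeff (scaleP x r) 0            ≡⟨ coeff-scaleP x r 0 ⟩
  x ℤ.* coeff r 0                 ∎
  where open ≡-Reasoning

coeff-mulP-suc : ∀ x p r k →
  coeff (mulP (x ∷ p) r) (suc k) ≡ x ℤ.* coeff r (suc k) ℤ.+ coeff (mulP p r) k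
coeff-mulP-suc x p r k = trans (coeff-addP (scaleP x r) _ (suc k))
  (cong (ℤ._+ coeff (mulP p r) k) (coeff-scaleP x r (suc k)))

≋-refl : ∀ {p} → p ≋ p
≋-refl = ⟨ (λ _ → refl) ⟩

≋-sym : ∀ {p r} → p ≋ r → r ≋ p
≋-sym e = ⟨ (λ k → sym (at e k)) ⟩

≋-trans : ∀ {p r s} → p ≋ r → r ≋ s → p ≋ s
≋-trans e f = ⟨ (λ k → trans (at e k) (at f k)) ⟩

≡⇒≋ : ∀ {p r} → p ≡ r → p ≋ r
≡⇒≋ refl = ≋-refl

∷-cong : ∀ {x y p r} → x ≡ y → p ≋ r → x ∷ p ≋ y ∷ r
∷-cong e f = ⟨ (λ { zero → e ; (suc k) → at f k }) ⟩

0∷[]≋[] : + 0 ∷ [] ≋ []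
0∷[]≋[] = ⟨ (λ { zero → refl ; (suc k) → refl }) ⟩

addP-cong : ∀ {p p′ r r′} → p ≋ p′ → r ≋ r′ → addP p r ≋ addP p′ r′
addP-cong {p} {p′} {r} {r′} e f = ⟨ (λ k → trans (coeff-addP p r k)
  (trans (cong₂ ℤ._+_ (at e k) (at f k)) (sym (coeff-addP p′ r′ k)))) ⟩

addP-comm : ∀ p r → addP p r ≋ addP r p
addP-comm p r = ⟨ (λ k → trans (coeff-addP p r k)
  (trans (ℤ.+-comm (coeff p k) _) (sym (coeff-addP r p k)))) ⟩

addP-assoc : ∀ p r s → addP (addP p r) s ≋ addP p (addP r s)
addP-assoc p r s = ⟨ (λ k → begin
  coeff (addP (addP p r) s) k                  ≡⟨ coeff-addP (addP p r) s k ⟩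
  coeff (addP p r) k ℤ.+ coeff s k             ≡⟨ cong (ℤ._+ coeff s k) (coeff-addP p r k) ⟩
  coeff p k ℤ.+ coeff r k ℤ.+ coeff s k        ≡⟨ ℤ.+-assoc (coeff p k) _ _ ⟩
  coeff p k ℤ.+ (coeff r k ℤ.+ coeff s k)      ≡⟨ cong (ℤ._+_ (coeff p k)) (coeff-addP r s k) ⟨
  coeff p k ℤ.+ coeff (addP r s) k             ≡⟨ coeff-addP p (addP r s) k ⟨
  coeff (addP p (addP r s)) k                  ∎) ⟩
  where open ≡-Reasoning

addP-identityʳ : ∀ p → addP p [] ≋ p
addP-identityʳ p = addP-comm p []

negP-cong : ∀ {p r} → p ≋ r → negP p ≋ negP r
negP-cong {p} {r} e = ⟨ (λ k → trans (coeff-negP p k)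
  (trans (cong (λ x → ℤ.- x) (at e k)) (sym (coeff-negP r k)))) ⟩

negP-inverseʳ : ∀ p → addP p (negP p) ≋ []
negP-inverseʳ p = ⟨ (λ k → trans (coeff-addP p (negP p) k)
  (trans (cong (ℤ._+_ (coeff p k)) (coeff-negP p k)) (ℤ.+-inverseʳ (coeff p k)))) ⟩

negP-inverseˡ : ∀ p → addP (negP p) p ≋ []
negP-inverseˡ p = ≋-trans (addP-comm (negP p) p) (negP-inverseʳ p)

mulP-congˡ : ∀ p {r s} → r ≋ s → mulP p r ≋ mulP p s
mulP-congˡ []      e = ≋-refl
mulP-congˡ (x ∷ p) {r} {s} e = addP-cong
  ⟨ (λ k → trans (coeff-scaleP x r k) (trans (cong (x ℤ.*_) (at e k)) (sym (coeff-scaleP x s k)))) ⟩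
  (∷-cong refl (mulP-congˡ p e))

mulP-zeroʳ : ∀ p → mulP p [] ≋ []
mulP-zeroʳ []      = ≋-refl
mulP-zeroʳ (x ∷ p) = ≋-trans (∷-cong refl (mulP-zeroʳ p)) 0∷[]≋[]

mulP-∷ʳ : ∀ p y r → mulP p (y ∷ r) ≋ addP (scaleP y p) (+ 0 ∷ mulP p r)
mulP-∷ʳ []      y r = ≋-sym 0∷[]≋[]
mulP-∷ʳ (x ∷ p) y r = ⟨ go ⟩
  where
  shuffle : ∀ a b c → a ℤ.+ (b ℤ.+ c) ≡ b ℤ.+ (a ℤ.+ c)
  shuffle = solve-∀

  go : mulP (x ∷ p) (y ∷ r) ≈ₚ addP (scaleP y (x ∷ p)) (+ 0 ∷ mulP (x ∷ p) r)
  go zero    = cong (ℤ._+ + 0) (ℤ.*-comm x y)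
  go (suc k) = begin
    coeff (addP (scaleP x r) (mulP p (y ∷ r))) k
      ≡⟨ coeff-addP (scaleP x r) _ k ⟩
    coeff (scaleP x r) k ℤ.+ coeff (mulP p (y ∷ r)) k
      ≡⟨ cong (ℤ._+_ (coeff (scaleP x r) k)) (at (mulP-∷ʳ p y r) k) ⟩
    coeff (scaleP x r) k ℤ.+ coeff (addP (scaleP y p) (+ 0 ∷ mulP p r)) k
      ≡⟨ cong (ℤ._+_ (coeff (scaleP x r) k)) (coeff-addP (scaleP y p) _ k) ⟩
    coeff (scaleP x r) k ℤ.+ (coeff (scaleP y p) k ℤ.+ coeff (+ 0 ∷ mulP p r) k)
      ≡⟨ shuffle (coeff (scaleP x r) k) (coeff (scaleP y p) k) (coeff (+ 0 ∷ mulP p r) k) ⟩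
    coeff (scaleP y p) k ℤ.+ (coeff (scaleP x r) k ℤ.+ coeff (+ 0 ∷ mulP p r) k)
      ≡⟨ cong (ℤ._+_ (coeff (scaleP y p) k)) (coeff-addP (scaleP x r) _ k) ⟨
    coeff (scaleP y p) k ℤ.+ coeff (mulP (x ∷ p) r) k
      ≡⟨ coeff-addP (scaleP y p) _ k ⟨
    coeff (addP (scaleP y p) (mulP (x ∷ p) r)) k ∎
    where open ≡-Reasoning

mulP-comm : ∀ p r → mulP p r ≋ mulP r p
mulP-comm []      r = ≋-sym (mulP-zeroʳ r)
mulP-comm (x ∷ p) r = ≋-trans
  (addP-cong ≋-refl (∷-cong refl (mulP-comm p r)))
  (≋-sym (mulP-∷ʳ r x p))

mulP-cong : ∀ {p p′ r r′} → p ≋ p′ → r ≋ r′ → mulP p r ≋ mulP p′ r′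
mulP-cong {p} {p′} {r} {r′} e f = ≋-trans (mulP-congˡ p f)
  (≋-trans (mulP-comm p r′) (≋-trans (mulP-congˡ r′ e) (mulP-comm r′ p′)))

scaleP-addP : ∀ c p r → scaleP c (addP p r) ≋ addP (scaleP c p) (scaleP c r)
scaleP-addP c p r = ⟨ (λ k → begin
  coeff (scaleP c (addP p r)) k                    ≡⟨ coeff-scaleP c (addP p r) k ⟩
  c ℤ.* coeff (addP p r) k                         ≡⟨ cong (c ℤ.*_) (coeff-addP p r k) ⟩
  c ℤ.* (coeff p k ℤ.+ coeff r k)                  ≡⟨ ℤ.*-distribˡ-+ c (coeff p k) _ ⟩
  c ℤ.* coeff p k ℤ.+ c ℤ.* coeff r k              ≡⟨ cong₂ ℤ._+_ (coeff-scaleP c p k) (coeff-scaleP c r k) ⟨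
  coeff (scaleP c p) k ℤ.+ coeff (scaleP c r) k    ≡⟨ coeff-addP (scaleP c p) _ k ⟨
  coeff (addP (scaleP c p) (scaleP c r)) k         ∎) ⟩
  where open ≡-Reasoning

scaleP-scaleP : ∀ c d p → scaleP c (scaleP d p) ≋ scaleP (c ℤ.* d) p
scaleP-scaleP c d p = ⟨ (λ k → begin
  coeff (scaleP c (scaleP d p)) k   ≡⟨ coeff-scaleP c (scaleP d p) k ⟩
  c ℤ.* coeff (scaleP d p) k        ≡⟨ cong (c ℤ.*_) (coeff-scaleP d p k) ⟩
  c ℤ.* (d ℤ.* coeff p k)           ≡⟨ ℤ.*-assoc c d _ ⟨
  c ℤ.* d ℤ.* coeff p k             ≡⟨ coeff-scaleP (c ℤ.* d) p k ⟨
  coeff (scaleP (c ℤ.* d) p) k      ∎) ⟩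
  where open ≡-Reasoning

addP-interchange : ∀ p r s t → addP (addP p r) (addP s t) ≋ addP (addP p s) (addP r t)
addP-interchange p r s t = ≋-trans (addP-assoc p r (addP s t)) (≋-trans
  (addP-cong {p} ≋-refl (≋-trans (≋-sym (addP-assoc r s t))
    (≋-trans (addP-cong (addP-comm r s) ≋-refl) (addP-assoc s r t))))
  (≋-sym (addP-assoc p s (addP r t))))

mulP-distribˡ : ∀ p r s → mulP p (addP r s) ≋ addP (mulP p r) (mulP p s)
mulP-distribˡ []      r s = ≋-refl
mulP-distribˡ (x ∷ p) r s = ≋-trans
  (addP-cong (scaleP-addP x r s) (∷-cong refl (mulP-distribˡ p r s)))
  (addP-interchange (scaleP x r) (scaleP x s) (+ 0 ∷ mulP p r) (+ 0 ∷ mulP p s))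

mulP-distribʳ : ∀ p r s → mulP (addP r s) p ≋ addP (mulP r p) (mulP s p)
mulP-distribʳ p r s = ≋-trans (mulP-comm (addP r s) p)
  (≋-trans (mulP-distribˡ p r s) (addP-cong (mulP-comm p r) (mulP-comm p s)))

mulP-scaleP : ∀ c p r → mulP (scaleP c p) r ≋ scaleP c (mulP p r)
mulP-scaleP c []      r = ≋-refl
mulP-scaleP c (x ∷ p) r = ≋-trans
  (addP-cong (≋-sym (scaleP-scaleP c x r))
    (∷-cong (sym (ℤ.*-zeroʳ c)) (mulP-scaleP c p r)))
  (≋-sym (scaleP-addP c (scaleP x r) (+ 0 ∷ mulP p r)))

scaleP-zero : ∀ p → scaleP (+ 0) p ≋ []
scaleP-zero p = ⟨ (λ k → trans (coeff-scaleP (+ 0) p k) (ℤ.*-zeroˡ (coeff p k))) ⟩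

scaleP-one : ∀ p → scaleP (+ 1) p ≋ p
scaleP-one p = ⟨ (λ k → trans (coeff-scaleP (+ 1) p k) (ℤ.*-identityˡ (coeff p k))) ⟩

mulP-shift : ∀ p r → mulP (+ 0 ∷ p) r ≋ + 0 ∷ mulP p r
mulP-shift p r = addP-cong (scaleP-zero r) ≋-refl

mulP-assoc : ∀ p r s → mulP (mulP p r) s ≋ mulP p (mulP r s)
mulP-assoc []      r s = ≋-refl
mulP-assoc (x ∷ p) r s = ≋-trans (mulP-distribʳ s (scaleP x r) (+ 0 ∷ mulP p r))
  (addP-cong (mulP-scaleP x r s)
    (≋-trans (mulP-shift (mulP p r) s) (∷-cong refl (mulP-assoc p r s))))

constP : ℤ → Poly
constP c = c ∷ []

mulP-constP : ∀ c p → mulP (constP c) p ≋ scaleP c p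
mulP-constP c p = ≋-trans (addP-cong ≋-refl 0∷[]≋[]) (addP-identityʳ (scaleP c p))

mulP-identityˡ : ∀ p → mulP oneP p ≋ p
mulP-identityˡ p = ≋-trans (mulP-constP (+ 1) p) (scaleP-one p)

-- Opaque copies of the operations keep Agda from unfolding ring expressions
-- whose arguments are explicit lists.
opaque
  infixl 6 _⊕_
  infixl 7 _⊗_
  infix  8 ⊝_

  _⊕_ _⊗_ : Poly → Poly → Poly
  _⊕_ = addP
  _⊗_ = mulP

  ⊝_ : Poly → Poly
  ⊝_ = negP

  0ᴾ 1ᴾ 𝐪 : Poly
  0ᴾ = []
  1ᴾ = oneP
  𝐪  = qP

  constᴾ : ℤ → Poly
  constᴾ = constP

opaque
  unfolding _⊕_

  ⊕≡addP : ∀ p r → p ⊕ r ≡ addP p r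
  ⊕≡addP p r = refl

  ⊗≡mulP : ∀ p r → p ⊗ r ≡ mulP p r
  ⊗≡mulP p r = refl

  0ᴾ≡[] : 0ᴾ ≡ []
  0ᴾ≡[] = refl

  1ᴾ≡oneP : 1ᴾ ≡ oneP
  1ᴾ≡oneP = refl

  ⊝1ᴾ≡ : ⊝ 1ᴾ ≡ ℤ.- (+ 1) ∷ []
  ⊝1ᴾ≡ = refl

  𝐪≡qP : 𝐪 ≡ qP
  𝐪≡qP = refl

  ∷≋ : ∀ x p → x ∷ p ≋ constᴾ x ⊕ 𝐪 ⊗ p
  ∷≋ x p = ≋-sym (≋-trans
    (addP-cong {constP x} ≋-refl (≋-trans (mulP-shift oneP p) (∷-cong refl (mulP-identityˡ p))))
    (∷-cong (ℤ.+-identityʳ x) ≋-refl))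

  const-⊗ : ∀ c p → constᴾ c ⊗ p ≋ scaleP c p
  const-⊗ = mulP-constP

  const-⊕ : ∀ c d → constᴾ (c ℤ.+ d) ≋ constᴾ c ⊕ constᴾ d
  const-⊕ c d = ≋-refl

  const-1 : constᴾ (+ 1) ≡ 1ᴾ
  const-1 = refl

  coeff-⊕ : ∀ p r k → coeff (p ⊕ r) k ≡ coeff p k ℤ.+ coeff r k
  coeff-⊕ = coeff-addP

  coeff-⊗-zero : ∀ p r → coeff (p ⊗ r) 0 ≡ coeff p 0 ℤ.* coeff r 0
  coeff-⊗-zero = coeff-mulP-zero

  ⊗-∷ʳ : ∀ p y r k →
    coeff (p ⊗ (y ∷ r)) k ≡ y ℤ.* coeff p k ℤ.+ coeff (+ 0 ∷ p ⊗ r) k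
  ⊗-∷ʳ p y r k = trans (at (mulP-∷ʳ p y r) k) (trans (coeff-addP (scaleP y p) _ k)
    (cong (λ c → c ℤ.+ coeff (+ 0 ∷ mulP p r) k) (coeff-scaleP y p k)))

  ⊕-⊗-isCommutativeRing : IsCommutativeRing _≋_ _⊕_ _⊗_ ⊝_ 0ᴾ 1ᴾ
  ⊕-⊗-isCommutativeRing = record
    { isRing = record
      { +-isAbelianGroup = record
        { isGroup = record
          { isMonoid = record
            { isSemigroup = record
              { isMagma = record
                { isEquivalence = record { refl = ≋-refl ; sym = ≋-sym ; trans = ≋-trans }
                ; ∙-cong = addP-cong }
              ; assoc = addP-assoc }
            ; identity = (λ _ → ≋-refl) , addP-identityʳ }
          ; inverse = negP-inverseˡ , negP-inverseʳ
          ; ⁻¹-cong = negP-cong }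
        ; comm = addP-comm }
      ; *-cong = mulP-cong
      ; *-assoc = mulP-assoc
      ; *-identity = mulP-identityˡ ,
          λ p → ≋-trans (mulP-comm p oneP) (mulP-identityˡ p)
      ; distrib = mulP-distribˡ , mulP-distribʳ }
    ; *-comm = mulP-comm }

polyRing : CommutativeRing 0ℓ 0ℓ
polyRing = record { isCommutativeRing = ⊕-⊗-isCommutativeRing }

-- Evaluation of integer polynomials in a commutative ring.

module _ {c ℓ} (A : CommutativeRing c ℓ) where
  open CommutativeRing A renaming (refl to ≈-refl; sym to ≈-sym; trans to ≈-trans)
  open import Algebra.Properties.Semiring.Exp semiring using (_^_; ^-congˡ)
  open import Algebra.Solver.Ring.NaturalCoefficients.Default commutativeSemiring
    using (solve; _:+_; _:*_; _:=_)
  open SetoidReasoning setoid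

  module Evaluation
    (ι : ℤ → Carrier) (ι-0 : ι (+ 0) ≈ 0#) (ι-1 : ι (+ 1) ≈ 1#)
    (ι-+ : ∀ x y → ι (x ℤ.+ y) ≈ ι x + ι y) (ι-* : ∀ x y → ι (x ℤ.* y) ≈ ι x * ι y)
    (ζ : Carrier) where

    ev : Poly → Carrier
    ev []      = 0#
    ev (x ∷ p) = ι x + ζ * ev p

    -- Equal polynomials may be lists of different lengths; the excess entries are zero, so the
    -- longer list is compared with `[]` along its tail.
    ev-cong : ∀ {p r} → p ≋ r → ev p ≈ ev r
    ev-cong {[]}    {[]}    e = ≈-refl
    ev-cong {[]}    {y ∷ r} e = ≈-sym (≈-trans
      (+-cong (≈-trans (reflexive (cong ι (sym (at e 0)))) ι-0)
        (≈-trans (*-congˡ (≈-sym (ev-cong {[]} {r} ⟨ (λ k → at e (suc k)) ⟩))) (zeroʳ ζ)))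
      (+-identityˡ 0#))
    ev-cong {x ∷ p} {[]}    e = ≈-trans
      (+-cong (≈-trans (reflexive (cong ι (at e 0))) ι-0)
        (≈-trans (*-congˡ (ev-cong {p} {[]} ⟨ (λ k → at e (suc k)) ⟩)) (zeroʳ ζ)))
      (+-identityˡ 0#)
    ev-cong {x ∷ p} {y ∷ r} e =
      +-cong (reflexive (cong ι (at e 0))) (*-congˡ (ev-cong {p} {r} ⟨ (λ k → at e (suc k)) ⟩))

    ev-addP : ∀ p r → ev (addP p r) ≈ ev p + ev r
    ev-addP []      r       = ≈-sym (+-identityˡ (ev r))
    ev-addP (x ∷ p) []      = ≈-sym (+-identityʳ _)
    ev-addP (x ∷ p) (y ∷ r) = ≈-trans (+-cong (ι-+ x y) (*-congˡ (ev-addP p r)))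
      (rearrange (ι x) (ι y) ζ (ev p) (ev r))
      where
      rearrange : ∀ x y z p r → (x + y) + z * (p + r) ≈ (x + z * p) + (y + z * r)
      rearrange = solve 5 (λ x y z p r → (x :+ y) :+ z :* (p :+ r) := (x :+ z :* p) :+ (y :+ z :* r)) ≈-refl

    ev-scaleP : ∀ c p → ev (scaleP c p) ≈ ι c * ev p
    ev-scaleP c []      = ≈-sym (zeroʳ (ι c))
    ev-scaleP c (x ∷ p) = ≈-trans (+-cong (ι-* c x) (*-congˡ (ev-scaleP c p)))
      (rearrange (ι c) (ι x) ζ (ev p))
      where
      rearrange : ∀ c x z p → c * x + z * (c * p) ≈ c * (x + z * p)
      rearrange = solve 4 (λ c x z p → c :* x :+ z :* (c :* p) := c :* (x :+ z :* p)) ≈-refl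

    ev-mulP : ∀ p r → ev (mulP p r) ≈ ev p * ev r
    ev-mulP []      r = ≈-sym (zeroˡ (ev r))
    ev-mulP (x ∷ p) r = begin
      ev (addP (scaleP x r) (+ 0 ∷ mulP p r))           ≈⟨ ev-addP (scaleP x r) (+ 0 ∷ mulP p r) ⟩
      ev (scaleP x r) + (ι (+ 0) + ζ * ev (mulP p r))   ≈⟨ +-cong (ev-scaleP x r) (+-cong ι-0 (*-congˡ (ev-mulP p r))) ⟩
      ι x * ev r + (0# + ζ * (ev p * ev r))             ≈⟨ +-congˡ (+-identityˡ _) ⟩
      ι x * ev r + ζ * (ev p * ev r)                    ≈⟨ rearrange (ι x) (ev r) ζ (ev p) ⟩
      (ι x + ζ * ev p) * ev r                           ∎
      where
      rearrange : ∀ x r z p → x * r + z * (p * r) ≈ (x + z * p) * r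
      rearrange = solve 4 (λ x r z p → x :* r :+ z :* (p :* r) := (x :+ z :* p) :* r) ≈-refl

    ev-oneP : ev oneP ≈ 1#
    ev-oneP = ≈-trans (+-cong ι-1 (zeroʳ ζ)) (+-identityʳ 1#)

    ev-powP : ∀ p k → ev (powP p k) ≈ ev p ^ k
    ev-powP p zero    = ev-oneP
    ev-powP p (suc k) = ≈-trans (ev-mulP p (powP p k)) (*-congˡ (ev-powP p k))

    ev-qP : ev qP ≈ ζ
    ev-qP = ≈-trans (+-cong ι-0 (*-congˡ ev-oneP)) (≈-trans (+-identityˡ _) (*-identityʳ ζ))

    ev-onePlusQ : ev onePlusQ ≈ 1# + ζ
    ev-onePlusQ = +-cong ι-1 (≈-trans (*-congˡ ev-oneP) (*-identityʳ ζ))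

    ev-⊕ : ∀ p r → ev (p ⊕ r) ≈ ev p + ev r
    ev-⊕ p r = ≈-trans (reflexive (cong ev (⊕≡addP p r))) (ev-addP p r)

    ev-⊗ : ∀ p r → ev (p ⊗ r) ≈ ev p * ev r
    ev-⊗ p r = ≈-trans (reflexive (cong ev (⊗≡mulP p r))) (ev-mulP p r)

    ev-0ᴾ : ev 0ᴾ ≈ 0#
    ev-0ᴾ = reflexive (cong ev 0ᴾ≡[])

    ev-1ᴾ : ev 1ᴾ ≈ 1#
    ev-1ᴾ = ≈-trans (reflexive (cong ev 1ᴾ≡oneP)) ev-oneP

    ι-^ : ∀ x k → ι (x ℤ.^ k) ≈ ι x ^ k
    ι-^ x zero    = ι-1
    ι-^ x (suc k) = ≈-trans (ι-* x (x ℤ.^ k)) (*-congˡ (ι-^ x k))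

    -- Nothing is known of the individual γ_j, so the two sums are matched term by term up to a
    -- common factor w. The bound on j makes φ(n) - 2j a true subtraction. The uses are ζ = 0 and ζ
    -- = 1 with w = 1, and ζ = ω with w = (1 + ω)^φ(n).
    ev-lucasExpansion : ∀ n γ s t w → (∀ j → j ≤ totient n ℕ./ 2 →
        ζ ^ j * (1# + ζ) ^ (totient n ∸ 2 ℕ.* j) ≈ w * (ι s ^ (totient n ∸ 2 ℕ.* j) * ι (ℤ.- t) ^ j)) →
      ev (lucasExpansion n γ) ≈ w * ι (lucasAtom n γ s t)
    ev-lucasExpansion n γ s t w same = sums (List.upTo (totient n ℕ./ 2 ℕ.+ 1))
      (All.map (λ {j} j< → same j (ℕ.s≤s⁻¹ (subst (j <_) (ℕ.+-comm _ 1) j<))) (all-upTo _))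
      where
      e : ℕ → ℕ
      e j = totient n ∸ 2 ℕ.* j

      rearrange : ∀ g w a b → g * (w * (a * b)) ≈ w * (g * a * b)
      rearrange = solve 4 (λ g w a b → g :* (w :* (a :* b)) := w :* (g :* a :* b)) ≈-refl

      term : ∀ j → ζ ^ j * (1# + ζ) ^ e j ≈ w * (ι s ^ e j * ι (ℤ.- t) ^ j) →
        ev (scaleP (γ j) (mulP (powP qP j) (powP onePlusQ (e j)))) ≈ w * ι (γ j ℤ.* (s ℤ.^ e j) ℤ.* ((ℤ.- t) ℤ.^ j))
      term j eq = begin
        ev (scaleP (γ j) (mulP (powP qP j) (powP onePlusQ (e j))))
          ≈⟨ ev-scaleP (γ j) (mulP (powP qP j) (powP onePlusQ (e j))) ⟩
        ι (γ j) * ev (mulP (powP qP j) (powP onePlusQ (e j)))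
          ≈⟨ *-congˡ (ev-mulP (powP qP j) _) ⟩
        ι (γ j) * (ev (powP qP j) * ev (powP onePlusQ (e j)))
          ≈⟨ *-congˡ (*-cong (≈-trans (ev-powP qP j) (^-congˡ j ev-qP))
                             (≈-trans (ev-powP onePlusQ (e j)) (^-congˡ (e j) ev-onePlusQ))) ⟩
        ι (γ j) * (ζ ^ j * (1# + ζ) ^ e j)
          ≈⟨ *-congˡ eq ⟩
        ι (γ j) * (w * (ι s ^ e j * ι (ℤ.- t) ^ j))
          ≈⟨ rearrange (ι (γ j)) w (ι s ^ e j) (ι (ℤ.- t) ^ j) ⟩
        w * (ι (γ j) * ι s ^ e j * ι (ℤ.- t) ^ j)
          ≈⟨ *-congˡ (*-cong (*-congˡ (ι-^ s (e j))) (ι-^ (ℤ.- t) j)) ⟨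
        w * (ι (γ j) * ι (s ℤ.^ e j) * ι ((ℤ.- t) ℤ.^ j))
          ≈⟨ *-congˡ (*-congʳ (ι-* (γ j) (s ℤ.^ e j))) ⟨
        w * (ι (γ j ℤ.* (s ℤ.^ e j)) * ι ((ℤ.- t) ℤ.^ j))
          ≈⟨ *-congˡ (ι-* (γ j ℤ.* (s ℤ.^ e j)) ((ℤ.- t) ℤ.^ j)) ⟨
        w * ι (γ j ℤ.* (s ℤ.^ e j) ℤ.* ((ℤ.- t) ℤ.^ j)) ∎

      expansionTerm : ℕ → Poly
      expansionTerm j = scaleP (γ j) (mulP (powP qP j) (powP onePlusQ (e j)))

      atomTerm : ℕ → ℤ
      atomTerm j = γ j ℤ.* (s ℤ.^ e j) ℤ.* ((ℤ.- t) ℤ.^ j)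

      sums : ∀ js → All (λ j → ζ ^ j * (1# + ζ) ^ e j ≈ w * (ι s ^ e j * ι (ℤ.- t) ^ j)) js →
        ev (sumP (List.map expansionTerm js)) ≈ w * ι (List.foldr ℤ._+_ (+ 0) (List.map atomTerm js))
      sums []       []         = ≈-sym (≈-trans (*-congˡ ι-0) (zeroʳ w))
      sums (j ∷ js) (eq ∷ eqs) = begin
        ev (addP (expansionTerm j) rest)           ≈⟨ ev-addP (expansionTerm j) rest ⟩
        ev (expansionTerm j) + ev rest             ≈⟨ +-cong (term j eq) (sums js eqs) ⟩
        w * ι (atomTerm j) + w * ι atomRest        ≈⟨ distribˡ w (ι (atomTerm j)) (ι atomRest) ⟨
        w * (ι (atomTerm j) + ι atomRest)          ≈⟨ *-congˡ (ι-+ (atomTerm j) atomRest) ⟨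
        w * ι (atomTerm j ℤ.+ atomRest)            ∎
        where
        rest     = sumP (List.map expansionTerm js)
        atomRest = List.foldr ℤ._+_ (+ 0) (List.map atomTerm js)

-- Long division by a monic polynomial.

open Rearrangement polyRing
open Geometric polyRing
open CommutativeRing polyRing
  using (semiring; setoid; +-congˡ; +-congʳ; +-cong; +-assoc; +-comm; +-identityʳ; +-identityˡ; -‿inverseʳ;
    *-congˡ; *-congʳ; *-cong; *-assoc; *-comm; *-identityˡ; *-identityʳ; distribˡ; zeroʳ)
open import Algebra.Properties.Semiring.Exp semiring using (^-congʳ; ^-homo-*) renaming (_^_ to _^ᴾ_)
open import Algebra.Properties.Semiring.Mult semiring using (×-assoc-*) renaming (_×_ to _×ᴾ_)
open import Algebra.Properties.Group (CommutativeRing.+-group polyRing) using (x∙y⁻¹≈ε⇒x≈y)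
module ≋-Reasoning = SetoidReasoning setoid

-- The functions quotient and subtractPrefix are the private qdiv and
-- subPrefix of Defs, which can only be reached by unification.
mutual
  quotient : ℕ → List ℤ → List ℤ → List ℤ
  quotient = _

  divMonic≡quotient : ∀ f g → divMonic f g ≡ reverse
    (quotient (length f ∸ length (drop 1 (reverse g))) (reverse f) (drop 1 (reverse g)))
  -- Abstraction turns the arguments of the hidden function into distinct variables, so that
  -- `quotient` is determined by unification; abstracting the `foldl` hides the outer `reverse`,
  -- whose arguments are then compared.
  divMonic≡quotient f g with drop 1 (reverse g)
  ... | gt with length f ∸ length gt | reverse f
  ... | k | rf with foldl (λ (l : List ℤ) (c : ℤ) → c ∷ l) []
  ... | rev = refl

mutual
  subtractPrefix : List ℤ → List ℤ → List ℤ
  subtractPrefix = _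

  quotient-∷ : ∀ k c f gt →
    quotient (suc k) (c ∷ f) gt ≡ c ∷ quotient k (subtractPrefix f (scaleP c gt)) gt
  quotient-∷ k c f gt with scaleP c gt
  ... | cgt = refl

[]≋0ᴾ : [] ≋ 0ᴾ
[]≋0ᴾ = ≡⇒≋ (sym 0ᴾ≡[])

⊗-[] : ∀ p {r} → r ≋ [] → p ⊗ r ≋ []
⊗-[] p e = ≋-trans (*-congˡ (≋-trans e []≋0ᴾ)) (≋-trans (zeroʳ p) (≋-sym []≋0ᴾ))

coeff-length≤ : ∀ p {k} → length p ≤ k → coeff p k ≡ + 0
coeff-length≤ []      _        = refl
coeff-length≤ (x ∷ p) (s≤s le) = coeff-length≤ p le

coeff-∷ʳ : ∀ p c → coeff (p ∷ʳ c) (length p) ≡ c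
coeff-∷ʳ []      c = refl
coeff-∷ʳ (x ∷ p) c = coeff-∷ʳ p c

∷ʳ≋ : ∀ p c → p ∷ʳ c ≋ p ⊕ constᴾ c ⊗ (𝐪 ^ᴾ length p)
∷ʳ≋ []      c = begin
  c ∷ []                      ≈⟨ ∷≋ c [] ⟩
  constᴾ c ⊕ 𝐪 ⊗ []           ≈⟨ +-congˡ (*-congˡ []≋0ᴾ) ⟩
  constᴾ c ⊕ 𝐪 ⊗ 0ᴾ           ≈⟨ +-congˡ (zeroʳ 𝐪) ⟩
  constᴾ c ⊕ 0ᴾ               ≈⟨ +-comm (constᴾ c) 0ᴾ ⟩
  0ᴾ ⊕ constᴾ c               ≈⟨ +-cong []≋0ᴾ (*-identityʳ (constᴾ c)) ⟨
  [] ⊕ constᴾ c ⊗ 1ᴾ          ∎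
  where open ≋-Reasoning
∷ʳ≋ (x ∷ p) c = begin
  x ∷ (p ∷ʳ c)
    ≈⟨ ∷≋ x (p ∷ʳ c) ⟩
  constᴾ x ⊕ 𝐪 ⊗ (p ∷ʳ c)
    ≈⟨ +-congˡ {constᴾ x} (*-congˡ {𝐪} (∷ʳ≋ p c)) ⟩
  constᴾ x ⊕ (𝐪 ⊗ (p ⊕ constᴾ c ⊗ (𝐪 ^ᴾ length p)))
    ≈⟨ rearrange₁ (constᴾ x) 𝐪 p (constᴾ c) (𝐪 ^ᴾ length p) ⟩
  (constᴾ x ⊕ 𝐪 ⊗ p) ⊕ (constᴾ c ⊗ (𝐪 ^ᴾ suc (length p)))
    ≈⟨ +-congʳ (≋-sym (∷≋ x p)) ⟩
  (x ∷ p) ⊕ (constᴾ c ⊗ (𝐪 ^ᴾ suc (length p))) ∎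
  where open ≋-Reasoning

-- Division runs on lists with the highest degree first. Such a list stands for the polynomial
-- `reverse f`, and its head is the top coefficient.
reverse-∷≋ : ∀ c f → reverse (c ∷ f) ≋ reverse f ⊕ constᴾ c ⊗ (𝐪 ^ᴾ length f)
reverse-∷≋ c f = begin
  reverse (c ∷ f)
    ≡⟨ List.unfold-reverse c f ⟩
  reverse f ∷ʳ c
    ≈⟨ ∷ʳ≋ (reverse f) c ⟩
  reverse f ⊕ (constᴾ c ⊗ (𝐪 ^ᴾ length (reverse f)))
    ≡⟨ cong (λ l → reverse f ⊕ constᴾ c ⊗ (𝐪 ^ᴾ l)) (List.length-reverse f) ⟩
  reverse f ⊕ constᴾ c ⊗ (𝐪 ^ᴾ length f) ∎
  where open ≋-Reasoning

reverse-scaleP : ∀ c g → reverse (scaleP c g) ≋ constᴾ c ⊗ reverse g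
reverse-scaleP c g = begin
  reverse (scaleP c g)               ≡⟨ List.reverse-map (c ℤ.*_) g ⟨
  scaleP c (reverse g)               ≈⟨ const-⊗ c (reverse g) ⟨
  constᴾ c ⊗ reverse g        ∎
  where open ≋-Reasoning

-- The hypothesis keeps g from being longer than f, the one case in which the subtraction lengthens
-- the list.
length-subtractPrefix : ∀ {k} f g → length f ≡ k ℕ.+ length g → length (subtractPrefix f g) ≡ length f
length-subtractPrefix         f       []      e = refl
length-subtractPrefix {k}     []      (y ∷ g) e = contradiction (trans e (ℕ.+-suc k (length g))) λ ()
length-subtractPrefix {k}     (x ∷ f) (y ∷ g) e =
  cong suc (length-subtractPrefix {k} f g (ℕ.suc-injective (trans e (ℕ.+-suc k (length g)))))

-- The lists are aligned at the top degree, so as a polynomial g is shifted by q^k, where k counts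
-- the further coefficients of f. Each entry x of f facing y is split as (x - y) + y.
reverse-subtractPrefix : ∀ {k} f g → length f ≡ k ℕ.+ length g →
  reverse f ≋ reverse (subtractPrefix f g) ⊕ (𝐪 ^ᴾ k) ⊗ reverse g
reverse-subtractPrefix {k} f       []      e =
  ≋-sym (≋-trans (+-congˡ (≋-trans (*-congˡ []≋0ᴾ) (zeroʳ (𝐪 ^ᴾ k)))) (+-identityʳ (reverse f)))
reverse-subtractPrefix {k} []      (y ∷ g) e = contradiction (trans e (ℕ.+-suc k (length g))) λ ()
reverse-subtractPrefix {k} (x ∷ f) (y ∷ g) e = begin
  reverse (x ∷ f)
    ≈⟨ reverse-∷≋ x f ⟩
  reverse f ⊕ constᴾ x ⊗ (𝐪 ^ᴾ length f)
    ≈⟨ +-cong (reverse-subtractPrefix {k} f g e′) (*-cong {constᴾ x} const-split power) ⟩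
  (s ⊕ (𝐪 ^ᴾ k) ⊗ reverse g) ⊕ ((constᴾ (x ℤ.- y) ⊕ constᴾ y) ⊗ ((𝐪 ^ᴾ k) ⊗ (𝐪 ^ᴾ length g)))
    ≈⟨ rearrange₂ s (𝐪 ^ᴾ k) (reverse g) (constᴾ (x ℤ.- y)) (constᴾ y) (𝐪 ^ᴾ length g) ⟩
  (s ⊕ (constᴾ (x ℤ.- y) ⊗ ((𝐪 ^ᴾ k) ⊗ (𝐪 ^ᴾ length g)))) ⊕ ((𝐪 ^ᴾ k) ⊗ (reverse g ⊕ constᴾ y ⊗ (𝐪 ^ᴾ length g)))
    ≈⟨ +-cong (+-congˡ {s} (*-congˡ {constᴾ (x ℤ.- y)} (≋-sym power))) (*-congˡ {𝐪 ^ᴾ k} (≋-sym (reverse-∷≋ y g))) ⟩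
  (s ⊕ constᴾ (x ℤ.- y) ⊗ (𝐪 ^ᴾ length f)) ⊕ (𝐪 ^ᴾ k) ⊗ reverse (y ∷ g)
    ≡⟨ cong (λ l → (s ⊕ constᴾ (x ℤ.- y) ⊗ (𝐪 ^ᴾ l)) ⊕ (𝐪 ^ᴾ k) ⊗ reverse (y ∷ g))
         (length-subtractPrefix {k} f g e′) ⟨
  (s ⊕ (constᴾ (x ℤ.- y) ⊗ (𝐪 ^ᴾ length (subtractPrefix f g)))) ⊕ (𝐪 ^ᴾ k) ⊗ reverse (y ∷ g)
    ≈⟨ +-congʳ (≋-sym (reverse-∷≋ (x ℤ.- y) (subtractPrefix f g))) ⟩
  (reverse (subtractPrefix (x ∷ f) (y ∷ g))) ⊕ (𝐪 ^ᴾ k) ⊗ reverse (y ∷ g) ∎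
  where
  open ≋-Reasoning

  s = reverse (subtractPrefix f g)

  e′ : length f ≡ k ℕ.+ length g
  e′ = ℕ.suc-injective (trans e (ℕ.+-suc k (length g)))

  power : 𝐪 ^ᴾ length f ≋ (𝐪 ^ᴾ k) ⊗ (𝐪 ^ᴾ length g)
  power = ≋-trans (^-congʳ 𝐪 e′) (^-homo-* 𝐪 k (length g))

  const-split : constᴾ x ≋ constᴾ (x ℤ.- y) ⊕ constᴾ y
  const-split = ≋-trans (≡⇒≋ (cong constᴾ (sym (trans (ℤ.+-assoc x (ℤ.- y) y)
    (trans (cong (ℤ._+_ x) (ℤ.+-inverseˡ y)) (ℤ.+-identityʳ x)))))) (const-⊕ (x ℤ.- y) y)

length-quotient : ∀ k f gt → length f ≡ k ℕ.+ length gt → length (quotient k f gt) ≡ k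
length-quotient zero    f       gt e = refl
length-quotient (suc k) (c ∷ f) gt e =
  cong suc (length-quotient k (subtractPrefix f (scaleP c gt)) gt
    (trans (length-subtractPrefix {k} f (scaleP c gt)
      (trans (ℕ.suc-injective e) (cong (k ℕ.+_) (sym (List.length-map _ gt)))))
      (ℕ.suc-injective e)))

-- A step with k quotient coefficients still to come removes the head c: c q^(k + length gt)
-- together with c q^k times the tail of the divisor is c q^k times the whole monic divisor. The
-- length of r bounds the degree of the remainder.
quotient-remainder : ∀ k f gt → length f ≡ k ℕ.+ length gt → ∃ λ r →
  length r ≤ length gt × reverse f ≋ reverse (+ 1 ∷ gt) ⊗ reverse (quotient k f gt) ⊕ r
quotient-remainder zero    f       gt e = reverse f ,
  ℕ.≤-reflexive (trans (List.length-reverse f) e) ,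
  ≋-sym (≋-trans (+-congʳ (≋-trans (*-congˡ []≋0ᴾ) (zeroʳ (reverse (+ 1 ∷ gt))))) (+-identityˡ (reverse f)))
quotient-remainder (suc k) (c ∷ f) gt e =
  let f′ = subtractPrefix f (scaleP c gt)
      e₁ = ℕ.suc-injective e
      e₂ = trans e₁ (cong (k ℕ.+_) (sym (List.length-map (c ℤ.*_) gt)))
      e₃ = trans (length-subtractPrefix {k} f (scaleP c gt) e₂) e₁
      r , r< , ih = quotient-remainder k f′ gt e₃
      Q = quotient k f′ gt
      G = reverse (+ 1 ∷ gt)
      a = 𝐪 ^ᴾ k
      b = 𝐪 ^ᴾ length gt
  in r , r< , (begin
  reverse (c ∷ f)
    ≈⟨ reverse-∷≋ c f ⟩
  reverse f ⊕ constᴾ c ⊗ (𝐪 ^ᴾ length f)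
    ≈⟨ +-cong (reverse-subtractPrefix {k} f (scaleP c gt) e₂)
         (*-congˡ {constᴾ c} (≋-trans (^-congʳ 𝐪 e₁) (^-homo-* 𝐪 k (length gt)))) ⟩
  (reverse f′ ⊕ a ⊗ reverse (scaleP c gt)) ⊕ constᴾ c ⊗ (a ⊗ b)
    ≈⟨ +-congʳ (+-cong ih (*-congˡ {a} (reverse-scaleP c gt))) ⟩
  ((G ⊗ reverse Q ⊕ r) ⊕ a ⊗ (constᴾ c ⊗ reverse gt)) ⊕ constᴾ c ⊗ (a ⊗ b)
    ≈⟨ rearrange₃ G (reverse Q) r a b (constᴾ c) (reverse gt) ⟩
  (G ⊗ reverse Q ⊕ constᴾ c ⊗ a ⊗ (reverse gt ⊕ 1ᴾ ⊗ b)) ⊕ r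
    ≈⟨ +-congʳ (+-congˡ {G ⊗ reverse Q} (*-congˡ {constᴾ c ⊗ a} (≋-trans (+-congˡ (*-congʳ (≡⇒≋ (sym const-1)))) (≋-sym (reverse-∷≋ (+ 1) gt))))) ⟩
  (G ⊗ reverse Q ⊕ constᴾ c ⊗ a ⊗ G) ⊕ r
    ≈⟨ +-congʳ (collect G (reverse Q) (constᴾ c ⊗ a)) ⟩
  G ⊗ (reverse Q ⊕ constᴾ c ⊗ a) ⊕ r
    ≡⟨ cong (λ l → (G ⊗ (reverse Q ⊕ constᴾ c ⊗ (𝐪 ^ᴾ l))) ⊕ r) (length-quotient k f′ gt e₃) ⟨
  (G ⊗ (reverse Q ⊕ constᴾ c ⊗ (𝐪 ^ᴾ length Q))) ⊕ r
    ≈⟨ +-congʳ (*-congˡ {G} (≋-sym (reverse-∷≋ c Q))) ⟩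
  G ⊗ reverse (c ∷ Q) ⊕ r ∎)
  where open ≋-Reasoning

-- Trailing zeros are excluded, since `divMonic` reads the degree from the length and takes the last
-- entry of the divisor to be its leading 1.
Monic : ℕ → Poly → Set
Monic d p = length p ≡ suc d × coeff p d ≡ + 1

length-addP-≤ : ∀ p r → length p ≤ length r → length (addP p r) ≡ length r
length-addP-≤ []      r       le       = refl
length-addP-≤ (x ∷ p) (y ∷ r) (s≤s le) = cong suc (length-addP-≤ p r le)

length-addP-≥ : ∀ p r → length r ≤ length p → length (addP p r) ≡ length p
length-addP-≥ []      []      le       = refl
length-addP-≥ (x ∷ p) []      le       = refl
length-addP-≥ (x ∷ p) (y ∷ r) (s≤s le) = cong suc (length-addP-≥ p r le)

length-mulP : ∀ x p r {e} → length r ≡ suc e → length (mulP (x ∷ p) r) ≡ suc (length p ℕ.+ e)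
length-mulP x []      r {e} lr = trans
  (length-addP-≥ (scaleP x r) (+ 0 ∷ []) (subst (1 ≤_) (sym (trans (List.length-map _ r) lr)) (s≤s z≤n)))
  (trans (List.length-map _ r) lr)
length-mulP x (y ∷ p) r {e} lr = trans
  (length-addP-≤ (scaleP x r) (+ 0 ∷ mulP (y ∷ p) r)
    (subst (_≤ suc (length (mulP (y ∷ p) r))) (sym (trans (List.length-map _ r) lr))
      (s≤s (subst (e ≤_) (sym ih) (ℕ.m≤n⇒m≤1+n (ℕ.m≤n+m e (length p)))))))
  (cong suc ih)
  where ih = length-mulP y p r lr

mulP-monic : ∀ {d e} p r → Monic d p → Monic e r → Monic (d ℕ.+ e) (mulP p r)
mulP-monic {d} {e} (x ∷ p) r (lp , cp) (lr , cr) =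
  trans (length-mulP x p r lr) (cong (λ l → suc (l ℕ.+ e)) (ℕ.suc-injective lp)) , lead x p lp cp
  where
  lead : ∀ {d} x p → length (x ∷ p) ≡ suc d → coeff (x ∷ p) d ≡ + 1 →
    coeff (mulP (x ∷ p) r) (d ℕ.+ e) ≡ + 1
  lead {zero} x [] lp refl = trans (at (mulP-identityˡ r) e) cr
  lead {suc d} x (y ∷ p) lp cp = trans (coeff-mulP-suc x (y ∷ p) r (d ℕ.+ e))
    (trans (cong₂ ℤ._+_
      (trans (cong (x ℤ.*_) (coeff-length≤ r (ℕ.≤-trans (ℕ.≤-reflexive lr) (s≤s (ℕ.m≤n+m e d))))) (ℤ.*-zeroʳ x))
      (lead y p (ℕ.suc-injective lp) cp))
    refl)

prodP-monic : ∀ {A : Set} (h : A → Poly) → (∀ a → ∃ λ d → Monic d (h a)) →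
  ∀ as → ∃ λ d → Monic d (prodP (List.map h as))
prodP-monic h m []       = 0 , refl , refl
prodP-monic h m (a ∷ as) = let d , md = m a ; e , me = prodP-monic h m as in
  d ℕ.+ e , mulP-monic (h a) (prodP (List.map h as)) md me

reverse-monic : ∀ {d} l → Monic d (reverse l) → ∃ λ gt → l ≡ + 1 ∷ gt × length gt ≡ d
reverse-monic (c ∷ l) (len , lead) = l , cong (_∷ l) c≡1 , len′
  where
  len′ = ℕ.suc-injective (trans (sym (List.length-reverse (c ∷ l))) len)
  c≡1 = trans (sym (coeff-∷ʳ (reverse l) c))
    (trans (cong₂ coeff (sym (List.unfold-reverse c l)) (trans (List.length-reverse l) len′)) lead)

monic-∷-reverse : ∀ l → Monic (length l) (reverse (+ 1 ∷ l))
monic-∷-reverse l = List.length-reverse (+ 1 ∷ l) ,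
  trans (cong₂ coeff (List.unfold-reverse (+ 1) l) (sym (List.length-reverse l))) (coeff-∷ʳ (reverse l) (+ 1))

-- A non-zero multiple of G has degree at least d. Write the multiplier as x + q h: above degree d
-- the term x G contributes nothing, so h vanishes by recursion, and then the coefficient of degree
-- d is x.
monic*-≋0 : ∀ {d} G → Monic d G → ∀ h → (∀ k → d ≤ k → coeff (G ⊗ h) k ≡ + 0) → h ≋ []
monic*-≋0 {d} G mG []      z = ≋-refl
monic*-≋0 {d} G mG@(len , lead) (x ∷ h) z = ≋-trans (∷-cong x≡0 h≋0) 0∷[]≋[]
  where
  expand : ∀ k → coeff (G ⊗ (x ∷ h)) k ≡ x ℤ.* coeff G k ℤ.+ coeff (+ 0 ∷ G ⊗ h) k
  expand = ⊗-∷ʳ G x h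

  h≋0 : h ≋ []
  h≋0 = monic*-≋0 G mG h λ k d≤k → trans (sym (trans (expand (suc k))
    (trans (cong (λ c → x ℤ.* c ℤ.+ coeff (G ⊗ h) k)
        (coeff-length≤ G (ℕ.≤-trans (ℕ.≤-reflexive len) (s≤s d≤k))))
      (trans (cong (ℤ._+ coeff (G ⊗ h) k) (ℤ.*-zeroʳ x)) (ℤ.+-identityˡ _)))))
    (z (suc k) (ℕ.m≤n⇒m≤1+n d≤k))

  Gh≋0 : + 0 ∷ G ⊗ h ≋ []
  Gh≋0 = ≋-trans (∷-cong refl (⊗-[] G h≋0)) 0∷[]≋[]

  x≡0 : x ≡ + 0
  x≡0 = trans (sym (trans (expand d) (trans (cong₂ ℤ._+_
      (trans (cong (x ℤ.*_) lead) (ℤ.*-identityʳ x)) (at Gh≋0 d)) (ℤ.+-identityʳ x)))) (z d ℕ.≤-refl)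

-- Uniqueness of division: if D is the computed quotient, W (Q - D) is the remainder, of degree
-- below that of W, so Q = D. The quotient is monic because its first computed coefficient is that
-- of F.
divMonic-exact : ∀ {n d F W Q} → Monic n F → Monic d W → F ≋ W ⊗ Q →
  divMonic F W ≋ Q × ∃ λ e → Monic e (divMonic F W)
divMonic-exact {n} {d} {F} {W} {Q} mF@(lenF , leadF) mW F≋WQ = exact
    (reverse-monic (reverse F) (subst (Monic n) (sym (List.reverse-involutive F)) mF))
    (reverse-monic (reverse W) (subst (Monic d) (sym (List.reverse-involutive W)) mW))
  where
  d≤n : d ≤ n
  d≤n with ℕ.≤-<-connex d n
  ... | inj₁ le = le
  -- For n < d the product W Q has no coefficients from degree d on, so Q and F vanish, against the
  -- leading coefficient 1 of F.
  ... | inj₂ n<d = contradiction (trans (sym leadF) (at F≋0 n)) λ ()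
    where
    F≋0 : F ≋ []
    F≋0 = ≋-trans F≋WQ (⊗-[] W (monic*-≋0 W mW Q λ k d≤k →
      trans (sym (at F≋WQ k)) (coeff-length≤ F (ℕ.≤-trans (ℕ.≤-reflexive lenF) (ℕ.≤-trans n<d d≤k)))))

  exact : (∃ λ ft → reverse F ≡ + 1 ∷ ft × length ft ≡ n) →
          (∃ λ gt → reverse W ≡ + 1 ∷ gt × length gt ≡ d) →
          divMonic F W ≋ Q × ∃ λ e → Monic e (divMonic F W)
  exact (ft , revF , len-ft) (gt , revW , len-gt) =
      ≋-trans (≡⇒≋ divMonic≡) D≋Q , _ , subst (Monic _) (sym divMonic≡) monic-D
    where
    k = n ∸ d
    -- F has n + 1 coefficients and gt has d, which leaves k + 1 quotient coefficients.
    D = reverse (quotient (suc k) (+ 1 ∷ ft) gt)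

    divMonic≡ : divMonic F W ≡ D
    divMonic≡ = trans (divMonic≡quotient F W) (trans
      (cong₂ (λ a b → reverse (quotient (length F ∸ length (drop 1 a)) b (drop 1 a))) revW revF)
      (cong (λ l → reverse (quotient l (+ 1 ∷ ft) gt))
        (trans (cong₂ _∸_ lenF len-gt) (ℕ.+-∸-assoc 1 d≤n))))

    len-f : suc (length ft) ≡ suc k ℕ.+ length gt
    len-f = cong suc (trans len-ft (sym (trans (cong (k ℕ.+_) len-gt) (ℕ.m∸n+n≡m d≤n))))

    monic-D : Monic (length (quotient k (subtractPrefix ft (scaleP (+ 1) gt)) gt)) D
    monic-D = monic-∷-reverse (quotient k (subtractPrefix ft (scaleP (+ 1) gt)) gt)

    r     = proj₁ (quotient-remainder (suc k) (+ 1 ∷ ft) gt len-f)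
    len-r = proj₁ (proj₂ (quotient-remainder (suc k) (+ 1 ∷ ft) gt len-f))
    eq    = proj₂ (proj₂ (quotient-remainder (suc k) (+ 1 ∷ ft) gt len-f))

    D≋Q : D ≋ Q
    D≋Q = ≋-sym (x∙y⁻¹≈ε⇒x≈y Q D (≋-trans (monic*-≋0 W mW (Q ⊕ (⊝ D)) (λ j d≤j →
        trans (at W[Q-D]≋r j) (coeff-length≤ r (ℕ.≤-trans len-r (ℕ.≤-trans (ℕ.≤-reflexive len-gt) d≤j))))) []≋0ᴾ))
      where
      F≋WD+r : F ≋ (W ⊗ D) ⊕ r
      F≋WD+r = subst (λ G → F ≋ (G ⊗ D) ⊕ r)
        (trans (cong reverse (sym revW)) (List.reverse-involutive W))
        (≋-trans (≡⇒≋ (sym (trans (cong reverse (sym revF)) (List.reverse-involutive F)))) eq)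
      W[Q-D]≋r : W ⊗ (Q ⊕ (⊝ D)) ≋ r
      W[Q-D]≋r = begin
        W ⊗ (Q ⊕ (⊝ D))                      ≈⟨ distribˡ W Q (⊝ D) ⟩
        (W ⊗ Q) ⊕ (W ⊗ (⊝ D))             ≈⟨ +-congʳ (≋-trans (≋-sym F≋WQ) (≋-trans F≋WD+r (+-comm (W ⊗ D) r))) ⟩
        (r ⊕ (W ⊗ D)) ⊕ (W ⊗ (⊝ D))    ≈⟨ +-assoc r (W ⊗ D) (W ⊗ (⊝ D)) ⟩
        r ⊕ ((W ⊗ D) ⊕ (W ⊗ (⊝ D)))    ≈⟨ +-congˡ {r} (≋-sym (distribˡ W D (⊝ D))) ⟩
        r ⊕ (W ⊗ (D ⊕ (⊝ D)))             ≈⟨ +-congˡ {r} (*-congˡ {W} (-‿inverseʳ D)) ⟩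
        r ⊕ (W ⊗ 0ᴾ)                            ≈⟨ +-congˡ {r} (zeroʳ W) ⟩
        r ⊕ 0ᴾ                                     ≈⟨ +-identityʳ r ⟩
        r                                             ∎
        where open ≋-Reasoning

-- Gauss's lemma for polynomials with constant coefficient ±1.

open Cancellation polyRing

powP≡^ : ∀ p k → powP p k ≡ p ^ᴾ k
powP≡^ p zero    = sym 1ᴾ≡oneP
powP≡^ p (suc k) = trans (cong (mulP p) (powP≡^ p k)) (sym (⊗≡mulP p (p ^ᴾ k)))

qPowMinusOne≡X : ∀ n → qPowMinusOne n ≡ X 𝐪 n
qPowMinusOne≡X n = trans
  (cong₂ addP (trans (powP≡^ qP n) (cong (_^ᴾ n) (sym 𝐪≡qP))) (sym ⊝1ᴾ≡))
  (sym (⊕≡addP (𝐪 ^ᴾ n) (⊝ 1ᴾ)))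

powP-qP-monic : ∀ k → Monic k (powP qP k)
powP-qP-monic zero    = refl , refl
powP-qP-monic (suc k) = mulP-monic qP (powP qP k) (refl , refl) (powP-qP-monic k)

qPowMinusOne-monic : ∀ n → Monic (suc n) (qPowMinusOne (suc n))
qPowMinusOne-monic n = let len , lead = powP-qP-monic (suc n) in
  trans (length-addP-≥ (powP qP (suc n)) _ (ℕ.≤-trans (s≤s z≤n) (ℕ.≤-reflexive (sym len)))) len ,
  trans (coeff-addP (powP qP (suc n)) _ (suc n)) (trans (ℤ.+-identityʳ _) lead)

-- Power series division by such a polynomial stays in ℤ.
UnitConstant : Poly → Set
UnitConstant p = ∃ λ v → coeff p 0 ℤ.* v ≡ + 1

-- Lowest coefficient first: c divides p₀ y with p₀ a unit, hence y; then y p can be subtracted and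
-- the tail treated in the same way. The case c = 0 is included.
∣-⊗-cancel : ∀ {c} p → UnitConstant p → ∀ h → (∀ k → c ∣ᶻ coeff (p ⊗ h) k) → ∀ k → c ∣ᶻ coeff h k
∣-⊗-cancel {c} p (v , pv) []      d k = ℤ∣.∣ᵤ⇒∣ (ℕ∣._∣0 _)
∣-⊗-cancel {c} p (v , pv) (y ∷ h) d = go
  where
  c∣y : c ∣ᶻ y
  c∣y = subst (c ∣ᶻ_) unscale (ℤ∣.∣m⇒∣m*n v (d 0))
    where
    unscale : coeff (p ⊗ (y ∷ h)) 0 ℤ.* v ≡ y
    unscale = trans (cong (ℤ._* v) (trans (⊗-∷ʳ p y h 0) (ℤ.+-identityʳ (y ℤ.* coeff p 0))))
      (trans (ℤ.*-assoc y (coeff p 0) v) (trans (cong (y ℤ.*_) pv) (ℤ.*-identityʳ y)))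

  go : ∀ k → c ∣ᶻ coeff (y ∷ h) k
  go zero    = c∣y
  go (suc k) = ∣-⊗-cancel p (v , pv) h (λ j → ℤ∣.∣m+n∣m⇒∣n
    (subst (c ∣ᶻ_) (⊗-∷ʳ p y h (suc j)) (d (suc j))) (ℤ∣.∣m⇒∣m*n (coeff p (suc j)) c∣y)) k

-- Divisibility by 0 is vanishing, so this is `∣-⊗-cancel` with c = 0, applied to p (h - h′).
⊗-cancelˡ : ∀ p → UnitConstant p → ∀ {h h′} → p ⊗ h ≋ p ⊗ h′ → h ≋ h′
⊗-cancelˡ p u {h} {h′} e = x∙y⁻¹≈ε⇒x≈y h h′ (≋-trans
  ⟨ (λ k → ℤ∣.0∣⇒≡0 (∣-⊗-cancel p u (h ⊕ ⊝ h′) (λ j →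
      subst (+ 0 ∣ᶻ_) (sym (at difference j)) ℤ∣.∣-refl) k)) ⟩ []≋0ᴾ)
  where
  difference : p ⊗ (h ⊕ ⊝ h′) ≋ []
  difference = begin
    p ⊗ (h ⊕ ⊝ h′)            ≈⟨ distribˡ p h (⊝ h′) ⟩
    p ⊗ h ⊕ p ⊗ ⊝ h′          ≈⟨ +-congʳ e ⟩
    p ⊗ h′ ⊕ p ⊗ ⊝ h′         ≈⟨ distribˡ p h′ (⊝ h′) ⟨
    p ⊗ (h′ ⊕ ⊝ h′)           ≈⟨ *-congˡ (-‿inverseʳ h′) ⟩
    p ⊗ 0ᴾ                    ≈⟨ zeroʳ p ⟩
    0ᴾ                        ≈⟨ []≋0ᴾ ⟨
    []                        ∎
    where open ≋-Reasoning

coeff-× : ∀ c h k → coeff ((c ×ᴾ 1ᴾ) ⊗ h) k ≡ + c ℤ.* coeff h k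
coeff-× c h k = trans (at (≋-trans (×-assoc-* c 1ᴾ h) (×ᴾ-congʳ c)) k) (go c)
  where
  ×ᴾ-congʳ : ∀ c → c ×ᴾ (1ᴾ ⊗ h) ≋ c ×ᴾ h
  ×ᴾ-congʳ zero    = ≋-refl
  ×ᴾ-congʳ (suc c) = +-cong (*-identityˡ h) (×ᴾ-congʳ c)

  go : ∀ c → coeff (c ×ᴾ h) k ≡ + c ℤ.* coeff h k
  go zero    = trans (cong (λ p → coeff p k) 0ᴾ≡[]) (sym (ℤ.*-zeroˡ (coeff h k)))
  go (suc c) = trans (coeff-⊕ h (c ×ᴾ h) k) (trans (cong (λ z → coeff h k ℤ.+ z) (go c)) (sym (ℤ.suc-* (+ c) (coeff h k))))

extract-factor : ∀ c h → (∀ k → + c ∣ᶻ coeff h k) → ∃ λ h′ → h ≋ (c ×ᴾ 1ᴾ) ⊗ h′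
extract-factor c h d = let h′ , e = go h d in h′ , ⟨ (λ k → trans (e k) (sym (coeff-× c h′ k))) ⟩
  where
  go : ∀ h → (∀ k → + c ∣ᶻ coeff h k) → ∃ λ h′ → ∀ k → coeff h k ≡ + c ℤ.* coeff h′ k
  go []      d = [] , λ k → sym (ℤ.*-zeroʳ (+ c))
  go (y ∷ h) d with divides y′ e ← d 0 | h′ , e′ ← go h (λ k → d (suc k)) =
    y′ ∷ h′ , λ { zero → trans e (ℤ.*-comm y′ (+ c)) ; (suc k) → e′ k }

-- c divides every coefficient of p k, hence every coefficient of k; after k is divided by c, the
-- factor c cancels from both sides.
gauss : ∀ c .{{_ : ℕ.NonZero c}} p → UnitConstant p → ∀ {k h} → p ⊗ k ≋ (c ×ᴾ 1ᴾ) ⊗ h → ∃ λ k′ → p ⊗ k′ ≋ h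
gauss c p u {k} {h} e = k′ , ⟨ (λ j → ℤ.*-cancelˡ-≡ (+ c) _ _
    (trans (sym (coeff-× c (p ⊗ k′) j)) (trans (at scaled j) (coeff-× c h j)))) ⟩
  where
  factored = extract-factor c k (∣-⊗-cancel p u k λ j →
    divides (coeff h j) (trans (at e j) (trans (coeff-× c h j) (ℤ.*-comm (+ c) (coeff h j)))))
  k′ = proj₁ factored

  scaled : (c ×ᴾ 1ᴾ) ⊗ (p ⊗ k′) ≋ (c ×ᴾ 1ᴾ) ⊗ h
  scaled = ≋-trans (swap-middle (c ×ᴾ 1ᴾ) p k′) (≋-trans (*-congˡ (≋-sym (proj₂ factored))) e)

-- Coprimality over ℚ with denominators cleared. The ideal itself may be proper: q - 1 and q + 1
-- generate 2 but not 1.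
Coprime : Poly → Poly → Set
Coprime a b = ∃ λ c → ℕ.NonZero c × (c ×ᴾ 1ᴾ) ∈⟨ a , b ⟩

UnitConstant-⊗ : ∀ {a b} → UnitConstant a → UnitConstant b → UnitConstant (a ⊗ b)
UnitConstant-⊗ {a} {b} (v , e) (w , f) = v ℤ.* w ,
  trans (cong (ℤ._* (v ℤ.* w)) (coeff-⊗-zero a b))
    (trans (rearrange (coeff a 0) (coeff b 0) v w) (cong₂ ℤ._*_ e f))
  where
  rearrange : ∀ a b v w → (a ℤ.* b) ℤ.* (v ℤ.* w) ≡ (a ℤ.* v) ℤ.* (b ℤ.* w)
  rearrange = solve-∀

-- With c = u a + v b one has c h = a b (u l + v k), and Gauss's lemma removes c.
coprime-⊗-divides : ∀ {a b h k l} → Coprime a b → UnitConstant a → UnitConstant b →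
  a ⊗ k ≋ h → b ⊗ l ≋ h → ∃ λ m → (a ⊗ b) ⊗ m ≋ h
coprime-⊗-divides {a} {b} (c , nz , u , v , e) ua ub p r =
  gauss c {{nz}} (a ⊗ b) (UnitConstant-⊗ {a} {b} ua ub) (coprime-combination e p r)

-- Products of cyclotomic polynomials and their coprimality.

open Bézout using (+-; -+)

opaque
  Φ : ℕ → Poly
  Φ = cyclotomic

  Φ≡cyclotomic : ∀ n → Φ n ≡ cyclotomic n
  Φ≡cyclotomic n = refl

opaque
  infix 4 _∣ᵇ_

  _∣ᵇ_ : ℕ → ℕ → Bool
  i ∣ᵇ n = does (i ∣? n)

  ∣ᵇ-true : ∀ {i n} → i ∣ⁿ n → (i ∣ᵇ n) ≡ true
  ∣ᵇ-true {i} {n} = dec-true (i ∣? n)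

  ∣ᵇ-false : ∀ {i n} → i ∤ⁿ n → (i ∣ᵇ n) ≡ false
  ∣ᵇ-false {i} {n} = dec-false (i ∣? n)

factor : (ℕ → Bool) → ℕ → Poly
factor P i = if P i then Φ i else 1ᴾ

∏Φ : (ℕ → Bool) → ℕ → Poly
∏Φ P zero    = 1ᴾ
∏Φ P (suc m) = ∏Φ P m ⊗ factor P (suc m)

∏Φ-cong : ∀ {P Q : ℕ → Bool} → (∀ i → P i ≡ Q i) → ∀ m → ∏Φ P m ≡ ∏Φ Q m
∏Φ-cong e zero    = refl
∏Φ-cong e (suc m) = cong₂ _⊗_ (∏Φ-cong e m) (cong (λ b → if b then Φ (suc m) else 1ᴾ) (e (suc m)))

∏Φ-split : ∀ (P Q : ℕ → Bool) m → ∏Φ P m ≋ ∏Φ (λ i → P i ∧ Q i) m ⊗ ∏Φ (λ i → P i ∧ not (Q i)) m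
∏Φ-split P Q zero    = ≋-sym (*-identityˡ 1ᴾ)
∏Φ-split P Q (suc m) = ≋-trans (*-cong (∏Φ-split P Q m) (split (P (suc m)) (Q (suc m))))
  (interchange (∏Φ P∧Q m) (∏Φ P∖Q m) (factor P∧Q (suc m)) (factor P∖Q (suc m)))
  where
  P∧Q P∖Q : ℕ → Bool
  P∧Q i = P i ∧ Q i
  P∖Q i = P i ∧ not (Q i)

  split : ∀ b c → (if b then Φ (suc m) else 1ᴾ)
    ≋ (if b ∧ c then Φ (suc m) else 1ᴾ) ⊗ (if b ∧ not c then Φ (suc m) else 1ᴾ)
  split false c     = ≋-sym (*-identityˡ 1ᴾ)
  split true  false = ≋-sym (*-identityˡ (Φ (suc m)))
  split true  true  = ≋-sym (*-identityʳ (Φ (suc m)))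

∏Φ-extend : ∀ {P : ℕ → Bool} {g m} → (∀ i → g < i → P i ≡ false) → g ≤ m → ∏Φ P m ≋ ∏Φ P g
∏Φ-extend {P} {g} {zero}  out z≤n = ≋-refl
∏Φ-extend {P} {g} {suc m} out le with ℕ.m≤n⇒m<n∨m≡n le
... | inj₂ refl      = ≋-refl
... | inj₁ (s≤s g≤m) = ≋-trans
  (*-cong (∏Φ-extend out g≤m) (≡⇒≋ (cong (λ b → if b then Φ (suc m) else 1ᴾ) (out (suc m) (s≤s g≤m)))))
  (*-identityʳ (∏Φ P g))

-- The identity that characterizes the Φ d. The lemmas that follow take it as a hypothesis because
-- they are applied inside the induction that proves it.
Factored : ℕ → Set
Factored n = X 𝐪 n ≋ ∏Φ (_∣ᵇ n) n

factored-suc : ∀ {n} → Factored (suc n) → X 𝐪 (suc n) ≋ ∏Φ (_∣ᵇ suc n) n ⊗ Φ (suc n)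
factored-suc {n} e = ≋-trans e (*-congˡ
  (≡⇒≋ (cong (λ b → if b then Φ (suc n) else 1ᴾ) (∣ᵇ-true {suc n} ℕ∣.∣-refl))))

coeff-X : ∀ n → coeff (X 𝐪 (suc n)) 0 ≡ ℤ.- (+ 1)
coeff-X n = trans (coeff-⊕ (𝐪 ⊗ 𝐪 ^ᴾ n) (⊝ 1ᴾ) 0)
  (cong₂ ℤ._+_
    (trans (coeff-⊗-zero 𝐪 (𝐪 ^ᴾ n)) (trans (cong (λ p → coeff p 0 ℤ.* coeff (𝐪 ^ᴾ n) 0) 𝐪≡qP) (ℤ.*-zeroˡ (coeff (𝐪 ^ᴾ n) 0))))
    (cong (λ p → coeff p 0) ⊝1ᴾ≡))

X-unitConstant : ∀ n → UnitConstant (X 𝐪 (suc n))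
X-unitConstant n = ℤ.- (+ 1) , cong (ℤ._* ℤ.- (+ 1)) (coeff-X n)

-- The constant coefficients satisfy a₀ b₀ = -1, so -b₀ is the inverse of a₀.
divisor-unitConstant : ∀ n a b → a ⊗ b ≋ X 𝐪 (suc n) → UnitConstant a
divisor-unitConstant n a b e = ℤ.- coeff b 0 ,
  trans (sym (ℤ.neg-distribʳ-* (coeff a 0) (coeff b 0)))
    (cong (λ x → ℤ.- x) (trans (sym (coeff-⊗-zero a b)) (trans (at e 0) (coeff-X n))))

-- What remains of (q^n - 1) / (q^g - 1), for g a proper divisor of n, once Φ n is taken out; the
-- range stops below n for that reason.
coDivisors : ℕ → ℕ → Poly
coDivisors (suc n) g = ∏Φ (λ i → (i ∣ᵇ suc n) ∧ not (i ∣ᵇ g)) n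
coDivisors zero    g = 1ᴾ

∧-∣ᵇ : ∀ {g n} → g ∣ⁿ n → ∀ i → (i ∣ᵇ n) ∧ (i ∣ᵇ g) ≡ (i ∣ᵇ g)
∧-∣ᵇ {g} {n} g∣n i with i ∣? g
... | yes i∣g rewrite ∣ᵇ-true i∣g | ∣ᵇ-true (ℕ∣.∣-trans i∣g g∣n) = refl
... | no  i∤g rewrite ∣ᵇ-false i∤g = ∧-zeroʳ (i ∣ᵇ n)

-- The proper divisors of n are sorted into divisors of g and others. The first kind multiply to q^g
-- - 1, which has constant coefficient -1 and can be cancelled.
Φ⊗coDivisors : ∀ k {g n} → Factored (suc g) → Factored n → n ≡ k ℕ.* suc g → suc g < n →
  Φ n ⊗ coDivisors n (suc g) ≋ geom 𝐪 (suc g) k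
Φ⊗coDivisors k {g} {suc n} fg fn n≡kg (s≤s g≤n) = ⊗-cancelˡ (X 𝐪 (suc g)) (X-unitConstant g) (begin
  X 𝐪 (suc g) ⊗ (Φ (suc n) ⊗ R)                ≈⟨ *-congˡ (*-comm (Φ (suc n)) R) ⟩
  X 𝐪 (suc g) ⊗ (R ⊗ Φ (suc n))                ≈⟨ *-assoc (X 𝐪 (suc g)) R (Φ (suc n)) ⟨
  X 𝐪 (suc g) ⊗ R ⊗ Φ (suc n)                  ≈⟨ *-congʳ (*-congʳ X≋) ⟩
  ∏Φ (λ i → (i ∣ᵇ suc n) ∧ (i ∣ᵇ suc g)) n ⊗ R ⊗ Φ (suc n)
                                               ≈⟨ *-congʳ (∏Φ-split (_∣ᵇ suc n) (_∣ᵇ suc g) n) ⟨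
  ∏Φ (_∣ᵇ suc n) n ⊗ Φ (suc n)                 ≈⟨ factored-suc fn ⟨
  X 𝐪 (suc n)                                  ≡⟨ cong (X 𝐪) n≡kg ⟩
  X 𝐪 (k ℕ.* suc g)                            ≈⟨ X-* 𝐪 k (suc g) ⟩
  X 𝐪 (suc g) ⊗ geom 𝐪 (suc g) k               ∎)
  where
  open ≋-Reasoning

  R = coDivisors (suc n) (suc g)

  X≋ : X 𝐪 (suc g) ≋ ∏Φ (λ i → (i ∣ᵇ suc n) ∧ (i ∣ᵇ suc g)) n
  X≋ = ≋-trans fg (≋-trans
    (≋-sym (∏Φ-extend (λ i g<i → ∣ᵇ-false (ℕ∣.>⇒∤ g<i)) g≤n))
    (≡⇒≋ (sym (∏Φ-cong (∧-∣ᵇ (ℕ∣.divides k n≡kg)) n))))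

Φ∣X : ∀ {d} n → Factored (suc d) → suc d ∣ⁿ n → ∃ λ k → Φ (suc d) ⊗ k ≋ X 𝐪 n
Φ∣X {d} n fd (ℕ∣.divides m eq) = ∏Φ (_∣ᵇ suc d) d ⊗ geom 𝐪 (suc d) m , (begin
  Φ (suc d) ⊗ (∏Φ (_∣ᵇ suc d) d ⊗ geom 𝐪 (suc d) m)    ≈⟨ *-assoc _ _ _ ⟨
  Φ (suc d) ⊗ ∏Φ (_∣ᵇ suc d) d ⊗ geom 𝐪 (suc d) m      ≈⟨ *-congʳ (*-comm _ _) ⟩
  ∏Φ (_∣ᵇ suc d) d ⊗ Φ (suc d) ⊗ geom 𝐪 (suc d) m      ≈⟨ *-congʳ (factored-suc fd) ⟨
  X 𝐪 (suc d) ⊗ geom 𝐪 (suc d) m                       ≈⟨ X-* 𝐪 m (suc d) ⟨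
  X 𝐪 (m ℕ.* suc d)                                    ≡⟨ cong (X 𝐪) eq ⟨
  X 𝐪 n                                                ∎)
  where open ≋-Reasoning

Φ-coprime : ∀ {d e} → suc d < e → (∀ i → suc i ≤ e → Factored (suc i)) → Coprime (Φ (suc d)) (Φ e)
Φ-coprime {d} {e@(suc _)} d<e fact
  with gcd (suc d) e | gcd-GCD (suc d) e | gcd[m,n]∣m (suc d) e | gcd[m,n]∣n (suc d) e
... | zero  | _       | g∣d | _ = contradiction (ℕ∣.0∣⇒≡0 g∣d) λ ()
... | suc g | gcd-g   | g∣d | ℕ∣.divides k e≡kg = k , nonZero k e≡kg , ∈-cancel
    (∈-resp (≋-trans (*-comm R (Φ e)) (≋-trans (Φ⊗coDivisors k fg fe e≡kg g<e) (geom≈ 𝐪 (suc g) k))) (∈-genʳ R))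
    (∈-resp (*-comm (geomQuotient 𝐪 (suc g) k) (X 𝐪 (suc g)))
      (∈-* (geomQuotient 𝐪 (suc g) k) (∈-trans (X-gcd (Bézout.identity gcd-g)) (Φ∈ˡ {suc d} (Φ∣X (suc d) fd ℕ∣.∣-refl)) (Φ∈ʳ {e} (Φ∣X e fe ℕ∣.∣-refl)))))
  where
  R = coDivisors e (suc g)
  g<e = ℕ.≤-<-trans (ℕ∣.∣⇒≤ g∣d) d<e
  fg = fact g (ℕ.<⇒≤ g<e)
  fd = fact d (ℕ.<⇒≤ d<e)
  fe = fact _ ℕ.≤-refl

  nonZero : ∀ k → e ≡ k ℕ.* suc g → ℕ.NonZero k
  nonZero (suc k) _ = _

  X-gcd : Bézout.Identity (suc g) (suc d) e → X 𝐪 (suc g) ∈⟨ X 𝐪 (suc d) , X 𝐪 e ⟩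
  X-gcd (+- m n eq) = X-bezout 𝐪 m n eq
  X-gcd (-+ m n eq) = ∈-swap 𝐪 (X-bezout 𝐪 n m eq)

  Φ∈ˡ : ∀ {n} → (∃ λ k → Φ (suc d) ⊗ k ≋ X 𝐪 n) → X 𝐪 n ∈⟨ Φ (suc d) , Φ e ⟩
  Φ∈ˡ (k , eq) = ∈-resp (≋-trans (*-comm k (Φ (suc d))) eq) (∈-genˡ k)

  Φ∈ʳ : ∀ {n} → (∃ λ k → Φ e ⊗ k ≋ X 𝐪 n) → X 𝐪 n ∈⟨ Φ (suc d) , Φ e ⟩
  Φ∈ʳ (k , eq) = ∈-resp (≋-trans (*-comm k (Φ e)) eq) (∈-genʳ k)

1ᴾ-coprime : ∀ b → Coprime 1ᴾ b
1ᴾ-coprime b = 1 , _ , ∈-resp (≋-trans (*-identityʳ 1ᴾ) (≋-sym (+-identityʳ 1ᴾ))) (∈-genˡ 1ᴾ)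

coprime-⊗ : ∀ {a a′ b} → Coprime a b → Coprime a′ b → Coprime (a ⊗ a′) b
coprime-⊗ (m , nz , p) (n , nz′ , p′) = m ℕ.* n , ℕ.m*n≢0 m n {{nz}} {{nz′}} , ∈-product {m = m} {n} p p′

∏Φ-coprime : ∀ P {e} m → m < e → (∀ i → suc i ≤ e → Factored (suc i)) → Coprime (∏Φ P m) (Φ e)
∏Φ-coprime P {e} zero    m<e fact = 1ᴾ-coprime (Φ e)
∏Φ-coprime P {e} (suc m) m<e fact = coprime-⊗ (∏Φ-coprime P m (ℕ.<-trans (ℕ.n<1+n m) m<e) fact) (choose (P (suc m)))
  where
  choose : ∀ b → Coprime (if b then Φ (suc m) else 1ᴾ) (Φ e)
  choose true  = Φ-coprime m<e fact
  choose false = 1ᴾ-coprime (Φ e)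

-- One divisor is added at a time by `coprime-⊗-divides`. Both unit conditions come for free, since
-- the two polynomials divide q^(n+1) - 1, whose constant coefficient is -1.
∏Φ∣X : ∀ {n} m → m ≤ n → (∀ i → suc i ≤ n → Factored (suc i)) → ∃ λ k → ∏Φ (_∣ᵇ suc n) m ⊗ k ≋ X 𝐪 (suc n)
∏Φ∣X {n} zero    m≤n fact = X 𝐪 (suc n) , *-identityˡ (X 𝐪 (suc n))
∏Φ∣X {n} (suc m) m<n fact with k , eq ← ∏Φ∣X m (ℕ.<⇒≤ m<n) fact | suc m ∣? suc n
... | no  m∤n rewrite ∣ᵇ-false m∤n = k , ≋-trans (*-congʳ (*-identityʳ (∏Φ (_∣ᵇ suc n) m))) eq
... | yes m∣n rewrite ∣ᵇ-true m∣n = let l , eq′ = Φ∣X (suc n) (fact m m<n) m∣n in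
  coprime-⊗-divides (∏Φ-coprime _ m ℕ.≤-refl (λ i le → fact i (ℕ.≤-trans le m<n)))
    (divisor-unitConstant n (∏Φ (_∣ᵇ suc n) m) k eq) (divisor-unitConstant n (Φ (suc m)) l eq′) eq eq′

-- The table of cyclotomic polynomials satisfies the factorization.

prodP-++ : ∀ as bs → prodP (as ++ bs) ≋ prodP as ⊗ prodP bs
prodP-++ []       bs = ≋-trans (≋-sym (*-identityˡ (prodP bs))) (*-congʳ (≡⇒≋ 1ᴾ≡oneP))
prodP-++ (a ∷ as) bs = begin
  mulP a (prodP (as ++ bs))          ≡⟨ ⊗≡mulP a (prodP (as ++ bs)) ⟨
  a ⊗ prodP (as ++ bs)               ≈⟨ *-congˡ (prodP-++ as bs) ⟩
  a ⊗ (prodP as ⊗ prodP bs)          ≈⟨ *-assoc a (prodP as) (prodP bs) ⟨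
  a ⊗ prodP as ⊗ prodP bs            ≡⟨ cong (_⊗ prodP bs) (⊗≡mulP a (prodP as)) ⟩
  mulP a (prodP as) ⊗ prodP bs       ∎
  where open ≋-Reasoning

-- `h` stands for `cycTable n`, which agrees with Φ only up to n. The list is split at its last
-- entry because `∏Φ` grows at that end.
prodP-filter : ∀ n m (h : ℕ → Poly) → (∀ i → i ≤ m → h i ≡ Φ i) →
  prodP (List.map h (List.filter (_∣? n) (List.applyUpTo suc m))) ≋ ∏Φ (_∣ᵇ n) m
prodP-filter n zero    h e = ≡⇒≋ (sym 1ᴾ≡oneP)
prodP-filter n (suc m) h e = begin
  prodP (List.map h (List.filter (_∣? n) (List.applyUpTo suc (suc m))))
    ≡⟨ cong (λ l → prodP (List.map h (List.filter (_∣? n) l))) (List.applyUpTo-∷ʳ suc m) ⟨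
  prodP (List.map h (List.filter (_∣? n) (List.applyUpTo suc m ∷ʳ suc m)))
    ≡⟨ cong (λ l → prodP (List.map h l)) (List.filter-++ (_∣? n) (List.applyUpTo suc m) (suc m ∷ [])) ⟩
  prodP (List.map h (List.filter (_∣? n) (List.applyUpTo suc m) ++ List.filter (_∣? n) (suc m ∷ [])))
    ≡⟨ cong prodP (List.map-++ h (List.filter (_∣? n) (List.applyUpTo suc m)) _) ⟩
  prodP (List.map h (List.filter (_∣? n) (List.applyUpTo suc m)) ++ List.map h (List.filter (_∣? n) (suc m ∷ [])))
    ≈⟨ prodP-++ (List.map h (List.filter (_∣? n) (List.applyUpTo suc m))) _ ⟩
  prodP (List.map h (List.filter (_∣? n) (List.applyUpTo suc m))) ⊗ prodP (List.map h (List.filter (_∣? n) (suc m ∷ [])))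
    ≈⟨ *-cong (prodP-filter n m h (λ i i≤m → e i (ℕ.m≤n⇒m≤1+n i≤m))) last ⟩
  ∏Φ (_∣ᵇ n) m ⊗ factor (_∣ᵇ n) (suc m) ∎
  where
  open ≋-Reasoning

  last : prodP (List.map h (List.filter (_∣? n) (suc m ∷ []))) ≋ factor (_∣ᵇ n) (suc m)
  last with suc m ∣? n
  ... | no  m∤n rewrite ∣ᵇ-false m∤n | List.filter-reject (_∣? n) {xs = []} m∤n = ≡⇒≋ (sym 1ᴾ≡oneP)
  ... | yes m∣n rewrite ∣ᵇ-true m∣n | List.filter-accept (_∣? n) {xs = []} m∣n = begin
    mulP (h (suc m)) oneP    ≡⟨ cong₂ mulP (e (suc m) ℕ.≤-refl) (sym 1ᴾ≡oneP) ⟩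
    mulP (Φ (suc m)) 1ᴾ      ≡⟨ ⊗≡mulP (Φ (suc m)) 1ᴾ ⟨
    Φ (suc m) ⊗ 1ᴾ           ≈⟨ *-identityʳ (Φ (suc m)) ⟩
    Φ (suc m)                ∎

cycTable-≢ : ∀ {n k} → ¬ (k ≡ suc n) → cycTable (suc n) k ≡ cycTable n k
cycTable-≢ {n} {k} k≢ with k ℕ.≟ suc n
... | yes e = contradiction e k≢
... | no  _ = refl

cycTable-suc : ∀ n → cycTable (suc n) (suc n) ≡
  divMonic (qPowMinusOne (suc n)) (prodP (List.map (cycTable n) (properDivisors (suc n))))
cycTable-suc n with suc n ℕ.≟ suc n
... | yes _ = refl
... | no ≢  = contradiction refl ≢

cycTable≡Φ : ∀ {n k} → k ≤ n → cycTable n k ≡ Φ k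
cycTable≡Φ {n} {k} k≤n with ℕ.m≤n⇒m<n∨m≡n k≤n
... | inj₂ refl                = sym (Φ≡cyclotomic k)
cycTable≡Φ {suc n} {k} k≤n | inj₁ k<n@(s≤s k≤n′) = trans (cycTable-≢ (ℕ.<⇒≢ k<n)) (cycTable≡Φ k≤n′)

-- The two halves need one joint induction. The factorizations up to n make the product over proper
-- divisors divide q^(n+1) - 1, and monicity gives `divMonic` correct lengths, so the new entry is
-- the exact cofactor and the factorization holds at n + 1. Monicity can cover all indices because
-- unfilled entries are 1.
cycTable-correct : ∀ n → (∀ k → ∃ λ d → Monic d (cycTable n k)) × (∀ i → suc i ≤ n → Factored (suc i))
cycTable-correct zero    = (λ _ → 0 , refl , refl) , λ _ ()
cycTable-correct (suc n) = monic , factored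
  where
  ih = cycTable-correct n
  W  = prodP (List.map (cycTable n) (properDivisors (suc n)))
  Wm = prodP-monic (cycTable n) (proj₁ ih) (properDivisors (suc n))
  W≋ : W ≋ ∏Φ (_∣ᵇ suc n) n
  W≋ = prodP-filter (suc n) n (cycTable n) (λ i → cycTable≡Φ)
  dvd = ∏Φ∣X n ℕ.≤-refl (proj₂ ih)
  exact = divMonic-exact {Q = proj₁ dvd} (qPowMinusOne-monic n) (proj₂ Wm)
    (≋-trans (≡⇒≋ (qPowMinusOne≡X (suc n))) (≋-trans (≋-sym (proj₂ dvd)) (*-congʳ (≋-sym W≋))))

  monic : ∀ k → ∃ λ d → Monic d (cycTable (suc n) k)
  monic k with k ℕ.≟ suc n
  ... | yes _ = proj₂ exact
  ... | no  _ = proj₁ ih k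

  Φ≋ : Φ (suc n) ≋ proj₁ dvd
  Φ≋ = ≋-trans (≡⇒≋ (trans (Φ≡cyclotomic (suc n)) (cycTable-suc n))) (proj₁ exact)

  factored : ∀ i → suc i ≤ suc n → Factored (suc i)
  factored i le with ℕ.m≤n⇒m<n∨m≡n le
  ... | inj₁ (s≤s lt) = proj₂ ih i lt
  ... | inj₂ refl     = ≋-trans (≋-sym (proj₂ dvd)) (*-congˡ (≋-trans (≋-sym Φ≋)
    (≡⇒≋ (cong (λ b → if b then Φ (suc n) else 1ᴾ) (sym (∣ᵇ-true {suc n} ℕ∣.∣-refl))))))

X≋∏Φ : ∀ n → Factored (suc n)
X≋∏Φ n = proj₂ (cycTable-correct (suc n)) n ℕ.≤-refl

-- The field with four elements.

-- (a , b) stands for a + b ω, where ω² = 1 + ω.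
𝔽₄ : Set
𝔽₄ = Parity × Parity

infixl 6 _+₄_
infixl 7 _*₄_

_+₄_ _*₄_ : 𝔽₄ → 𝔽₄ → 𝔽₄
(a , b) +₄ (c , d) = a ℙ.+ c , b ℙ.+ d
(a , b) *₄ (c , d) = (a ℙ.* c) ℙ.+ (b ℙ.* d) , (a ℙ.* d) ℙ.+ (b ℙ.* c) ℙ.+ (b ℙ.* d)

0₄ 1₄ ω : 𝔽₄
0₄ = 0ℙ , 0ℙ
1₄ = 1ℙ , 0ℙ
ω  = 0ℙ , 1ℙ

infix 4 _≟₄_

_≟₄_ : ∀ (x y : 𝔽₄) → Dec (x ≡ y)
_≟₄_ = ≡-dec ℙ._≟_ ℙ._≟_

-- Makes the field laws decidable, so that they are checked by evaluation.
every : ∀ {P : 𝔽₄ → Set} → (∀ x → Dec (P x)) → Dec (∀ x → P x)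
every {P} P? = map′
  (λ { (a , b , c , d) → λ { (0ℙ , 0ℙ) → a ; (0ℙ , 1ℙ) → b ; (1ℙ , 0ℙ) → c ; (1ℙ , 1ℙ) → d } })
  (λ f → f (0ℙ , 0ℙ) , f (0ℙ , 1ℙ) , f (1ℙ , 0ℙ) , f (1ℙ , 1ℙ))
  (P? (0ℙ , 0ℙ) ×-dec P? (0ℙ , 1ℙ) ×-dec P? (1ℙ , 0ℙ) ×-dec P? (1ℙ , 1ℙ))

+₄-assoc : ∀ x y z → (x +₄ y) +₄ z ≡ x +₄ (y +₄ z)
+₄-assoc = from-yes (every λ x → every λ y → every λ z → (x +₄ y) +₄ z ≟₄ (x +₄ (y +₄ z)))

+₄-comm : ∀ x y → x +₄ y ≡ y +₄ x
+₄-comm = from-yes (every λ x → every λ y → x +₄ y ≟₄ (y +₄ x))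

+₄-identityˡ : ∀ x → 0₄ +₄ x ≡ x
+₄-identityˡ x = refl

+₄-inverse : ∀ x → x +₄ x ≡ 0₄
+₄-inverse = from-yes (every λ x → (x +₄ x) ≟₄ 0₄)

*₄-assoc : ∀ x y z → (x *₄ y) *₄ z ≡ x *₄ (y *₄ z)
*₄-assoc = from-yes (every λ x → every λ y → every λ z → ((x *₄ y) *₄ z) ≟₄ (x *₄ (y *₄ z)))

*₄-comm : ∀ x y → x *₄ y ≡ y *₄ x
*₄-comm = from-yes (every λ x → every λ y → (x *₄ y) ≟₄ (y *₄ x))

*₄-identityˡ : ∀ x → 1₄ *₄ x ≡ x
*₄-identityˡ = from-yes (every λ x → (1₄ *₄ x) ≟₄ x)

*₄-distribˡ-+₄ : ∀ x y z → x *₄ (y +₄ z) ≡ x *₄ y +₄ x *₄ z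
*₄-distribˡ-+₄ = from-yes (every λ x → every λ y → every λ z → (x *₄ (y +₄ z)) ≟₄ (x *₄ y +₄ x *₄ z))

*₄-noZeroDivisors : ∀ x y → x *₄ y ≡ 0₄ → x ≡ 0₄ ⊎ y ≡ 0₄
*₄-noZeroDivisors = from-yes (every λ x → every λ y →
  ((x *₄ y) ≟₄ 0₄) →-dec ((x ≟₄ 0₄) ⊎-dec (y ≟₄ 0₄)))

field₄ : CommutativeRing 0ℓ 0ℓ
field₄ = record
  { Carrier = 𝔽₄ ; _≈_ = _≡_ ; _+_ = _+₄_ ; _*_ = _*₄_ ; -_ = λ x → x ; 0# = 0₄ ; 1# = 1₄
  ; isCommutativeRing = record
    { isRing = record
      { +-isAbelianGroup = record
        { isGroup = record
          { isMonoid = record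
            { isSemigroup = record
              { isMagma = record { isEquivalence = ≡.isEquivalence ; ∙-cong = cong₂ _+₄_ }
              ; assoc = +₄-assoc }
            ; identity = +₄-identityˡ , λ x → +₄-comm x 0₄ }
          ; inverse = +₄-inverse , +₄-inverse
          ; ⁻¹-cong = λ e → e }
        ; comm = +₄-comm }
      ; *-cong = cong₂ _*₄_
      ; *-assoc = *₄-assoc
      ; *-identity = *₄-identityˡ , λ x → trans (*₄-comm x 1₄) (*₄-identityˡ x)
      ; distrib = *₄-distribˡ-+₄ , λ x y z → trans (*₄-comm (y +₄ z) x)
          (trans (*₄-distribˡ-+₄ x y z) (cong₂ _+₄_ (*₄-comm x y) (*₄-comm x z))) }
    ; *-comm = *₄-comm } }

open import Algebra.Properties.Semiring.Exp (CommutativeRing.semiring field₄)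
  renaming (_^_ to _^₄_; ^-congˡ to ^₄-congˡ; ^-homo-* to ^₄-homo-*; ^-assocʳ to ^₄-assocʳ) using ()

-- Reduction of integers modulo 2.

par : ℤ → Parity
par z = ℕ.parity ℤ.∣ z ∣

par-⊖ : ∀ m n → par (m ℤ.⊖ n) ≡ ℕ.parity m ℙ.+ ℕ.parity n
par-⊖ zero    zero    = refl
par-⊖ zero    (suc n) = refl
par-⊖ (suc m) zero    = sym (ℙ.+-identityʳ (ℕ.parity (suc m)))
par-⊖ (suc m) (suc n) = begin
  par (suc m ℤ.⊖ suc n)                                  ≡⟨ cong par (ℤ.[1+m]⊖[1+n]≡m⊖n m n) ⟩
  par (m ℤ.⊖ n)                                          ≡⟨ par-⊖ m n ⟩
  ℕ.parity m ℙ.+ ℕ.parity n                              ≡⟨ cong₂ ℙ._+_ (ℙ.suc-homo-⁻¹ m) (ℙ.suc-homo-⁻¹ n) ⟨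
  ℕ.parity (suc m) ℙ.⁻¹ ℙ.+ ℕ.parity (suc n) ℙ.⁻¹        ≡⟨ flip-both (ℕ.parity (suc m)) (ℕ.parity (suc n)) ⟩
  ℕ.parity (suc m) ℙ.+ ℕ.parity (suc n)                  ∎
  where
  open ≡-Reasoning
  flip-both : ∀ p q → p ℙ.⁻¹ ℙ.+ q ℙ.⁻¹ ≡ p ℙ.+ q
  flip-both 0ℙ 0ℙ = refl
  flip-both 0ℙ 1ℙ = refl
  flip-both 1ℙ 0ℙ = refl
  flip-both 1ℙ 1ℙ = refl

par-+ : ∀ x y → par (x ℤ.+ y) ≡ par x ℙ.+ par y
par-+ (+ m)        (+ n)        = ℙ.+-homo-+ m n
par-+ (+ m)        ℤ.-[1+ n ]   = par-⊖ m (suc n)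
par-+ ℤ.-[1+ m ]   (+ n)        = trans (par-⊖ n (suc m)) (ℙ.+-comm (ℕ.parity n) (ℕ.parity (suc m)))
par-+ ℤ.-[1+ m ]   ℤ.-[1+ n ]   = trans (cong ℕ.parity (cong suc (sym (ℕ.+-suc m n)))) (ℙ.+-homo-+ (suc m) (suc n))

par-* : ∀ x y → par (x ℤ.* y) ≡ par x ℙ.* par y
par-* x y = trans (cong ℕ.parity (ℤ.abs-* x y)) (ℙ.*-homo-* ℤ.∣ x ∣ ℤ.∣ y ∣)

parity≡0⇒even : ∀ n → ℕ.parity n ≡ 0ℙ → 2 ∣ⁿ n
parity≡0⇒even zero          e = 2 ℕ∣.∣0
parity≡0⇒even (suc (suc n)) e = ℕ∣.∣m∣n⇒∣m+n ℕ∣.∣-refl (parity≡0⇒even n e)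

even⇒parity≡0 : ∀ {n} → 2 ∣ⁿ n → ℕ.parity n ≡ 0ℙ
even⇒parity≡0 (ℕ∣.divides q refl) = trans (ℙ.*-homo-* q 2) (ℙ.*-zeroʳ (ℕ.parity q))

oddPart : ∀ n → .{{_ : ℕ.NonZero n}} → ∃₂ λ a k → n ≡ k ℕ.* 2 ℕ.^ a × ℕ.parity k ≡ 1ℙ
oddPart = <-rec (λ n → .{{_ : ℕ.NonZero n}} → ∃₂ λ a k → n ≡ k ℕ.* 2 ℕ.^ a × ℕ.parity k ≡ 1ℙ) step
  where
  step : ∀ n → (∀ {m} → m < n → .{{_ : ℕ.NonZero m}} → ∃₂ λ a k → m ≡ k ℕ.* 2 ℕ.^ a × ℕ.parity k ≡ 1ℙ) →
    .{{_ : ℕ.NonZero n}} → ∃₂ λ a k → n ≡ k ℕ.* 2 ℕ.^ a × ℕ.parity k ≡ 1ℙ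
  step n rec with ℕ.parity n in eq
  ... | 1ℙ = 0 , n , sym (ℕ.*-identityʳ n) , eq
  ... | 0ℙ with parity≡0⇒even n eq
  ... | ℕ∣.divides m@(suc _) refl = let a , k , e , odd = rec (ℕ.m<m*n m 2 (s≤s (s≤s z≤n))) in
    suc a , k , trans (cong (ℕ._* 2) e) (trans (ℕ.*-assoc k (2 ℕ.^ a) 2) (cong (k ℕ.*_) (ℕ.*-comm (2 ℕ.^ a) 2))) , odd

ι₄ : ℤ → 𝔽₄
ι₄ z = par z , 0ℙ

ι₄-* : ∀ x y → ι₄ (x ℤ.* y) ≡ ι₄ x *₄ ι₄ y
ι₄-* x y with par x | par y | par-* x y
... | 0ℙ | _  | e = cong (_, 0ℙ) e
... | 1ℙ | 0ℙ | e = cong (_, 0ℙ) e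
... | 1ℙ | 1ℙ | e = cong (_, 0ℙ) e

module Evaluation₄ = Evaluation field₄ ι₄ refl refl (λ x y → cong (_, 0ℙ) (par-+ x y)) ι₄-*

ev-X : ∀ ζ n → Evaluation₄.ev ζ (X 𝐪 n) ≡ ζ ^₄ n +₄ 1₄
ev-X ζ n = trans (ev-⊕ (𝐪 ^ᴾ n) (⊝ 1ᴾ)) (cong₂ _+₄_
  (trans (cong ev (trans (cong (_^ᴾ n) 𝐪≡qP) (sym (powP≡^ qP n)))) (trans (ev-powP qP n) (^₄-congˡ n ev-qP)))
  (trans (cong ev ⊝1ᴾ≡) (trans (cong (1₄ +₄_) (*₄-comm ζ 0₄)) refl)))
  where open Evaluation₄ ζ

ev-× : ∀ ζ k → Evaluation₄.ev ζ (k ×ᴾ 1ᴾ) ≡ (ℕ.parity k , 0ℙ)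
ev-× ζ zero    = Evaluation₄.ev-0ᴾ ζ
ev-× ζ (suc k) = trans (ev-⊕ 1ᴾ (k ×ᴾ 1ᴾ)) (trans (cong₂ _+₄_ ev-1ᴾ (ev-× ζ k))
  (cong (_, 0ℙ) (sym (ℙ.+-homo-+ 1 k))))
  where open Evaluation₄ ζ

+₄1≡0⇒≡1 : ∀ x → x +₄ 1₄ ≡ 0₄ → x ≡ 1₄
+₄1≡0⇒≡1 = from-yes (every λ x → ((x +₄ 1₄) ≟₄ 0₄) →-dec (x ≟₄ 1₄))

2^∣2^ : ∀ {i j} → i ≤ j → 2 ℕ.^ i ∣ⁿ 2 ℕ.^ j
2^∣2^ {i} {j} i≤j = ℕ∣.divides (2 ℕ.^ (j ∸ i))
  (trans (cong (2 ℕ.^_) (sym (ℕ.m∸n+n≡m i≤j))) (ℕ.^-distribˡ-+-* 2 (j ∸ i) i))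

-- Zeros of Φ n at an element of order r.

-- `order` and `ζ^r≡1` say that r is the order of ζ. `base` is asked for r ≥ 2 only, since n = r
-- occurs among the n ≥ 2 only then; for ζ = 1 it is vacuous.
module Vanishing (ζ : 𝔽₄) (r : ℕ) .{{_ : ℕ.NonZero r}}
  (order : ∀ n → ζ ^₄ n ≡ 1₄ → r ∣ⁿ n) (ζ^r≡1 : ζ ^₄ r ≡ 1₄) (base : 2 ≤ r → Evaluation₄.ev ζ (Φ r) ≡ 0₄) where
  open Evaluation₄ ζ

  ev-X≡0 : ∀ k → ev (X 𝐪 (r ℕ.* k)) ≡ 0₄
  ev-X≡0 k = trans (ev-X ζ (r ℕ.* k)) (cong (_+₄ 1₄) (trans (sym (^₄-assocʳ ζ r k)) (trans (^₄-congˡ k ζ^r≡1) (1^ k))))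
    where
    1^ : ∀ k → 1₄ ^₄ k ≡ 1₄
    1^ zero    = refl
    1^ (suc k) = trans (*₄-identityˡ (1₄ ^₄ k)) (1^ k)

  -- ζ^g = 1 makes `X g` vanish, so `geom≈` leaves k modulo 2.
  ev-geom : ∀ g k → r ∣ⁿ g → ev (geom 𝐪 g k) ≡ (ℕ.parity k , 0ℙ)
  ev-geom g k (ℕ∣.divides q eq) = trans (ev-cong (geom≈ 𝐪 g k)) (trans (ev-⊕ (k ×ᴾ 1ᴾ) (X 𝐪 g ⊗ geomQuotient 𝐪 g k))
    (trans (cong₂ _+₄_ (ev-× ζ k) (trans (ev-⊗ (X 𝐪 g) (geomQuotient 𝐪 g k))
      (cong (_*₄ ev (geomQuotient 𝐪 g k)) (trans (cong (λ l → ev (X 𝐪 l)) (trans eq (ℕ.*-comm q r))) (ev-X≡0 q)))))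
    (+₄-comm (ℕ.parity k , 0ℙ) 0₄)))

  ev-Φ⊗ : ∀ k g n → .{{_ : ℕ.NonZero g}} → .{{_ : ℕ.NonZero n}} → n ≡ k ℕ.* g → g < n → r ∣ⁿ g →
    ev (Φ n) *₄ ev (coDivisors n g) ≡ (ℕ.parity k , 0ℙ)
  ev-Φ⊗ k (suc g) (suc n) e g<n r∣g = trans (sym (ev-⊗ (Φ (suc n)) (coDivisors (suc n) (suc g))))
    (trans (ev-cong (Φ⊗coDivisors k (X≋∏Φ g) (X≋∏Φ n) e g<n)) (ev-geom (suc g) k r∣g))

  r*2^-nonZero : ∀ a → ℕ.NonZero (r ℕ.* 2 ℕ.^ a)
  r*2^-nonZero a = ℕ.m*n≢0 r (2 ℕ.^ a) {{it}} {{ℕ.m^n≢0 2 a}}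

  vanishing⇒order∣ : ∀ n → ev (Φ (suc n)) ≡ 0₄ → r ∣ⁿ suc n
  vanishing⇒order∣ n z = order (suc n) (+₄1≡0⇒≡1 (ζ ^₄ suc n) (trans (sym (ev-X ζ (suc n))) X≡0))
    where
    X≡0 : ev (X 𝐪 (suc n)) ≡ 0₄
    X≡0 = trans (ev-cong (factored-suc (X≋∏Φ n))) (trans (ev-⊗ (∏Φ (_∣ᵇ suc n) n) (Φ (suc n)))
      (trans (cong (ev (∏Φ (_∣ᵇ suc n) n) *₄_) z) (*₄-comm (ev (∏Φ (_∣ᵇ suc n) n)) 0₄)))

  vanishing⇒quotient≡1 : ∀ k a n → suc n ≡ k ℕ.* (r ℕ.* 2 ℕ.^ a) → ℕ.parity k ≡ 1ℙ → ev (Φ (suc n)) ≡ 0₄ → k ≡ 1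
  vanishing⇒quotient≡1 (suc zero)      a n eq odd z = refl
  vanishing⇒quotient≡1 k@(suc (suc _)) a n eq odd z = contradiction (trans (sym odd) (cong proj₁ even)) λ ()
    where
    g = r ℕ.* 2 ℕ.^ a

    g<n : g < suc n
    g<n = subst (g <_) (trans (ℕ.*-comm g k) (sym eq)) (ℕ.m<m*n g k {{r*2^-nonZero a}} (s≤s (s≤s z≤n)))

    even : (ℕ.parity k , 0ℙ) ≡ 0₄
    even = trans (sym (ev-Φ⊗ k g (suc n) {{r*2^-nonZero a}} eq g<n (ℕ∣.m∣m*n (2 ℕ.^ a))))
      (cong (_*₄ ev (coDivisors (suc n) g)) z)

  vanishing⇒ : ∀ n → ev (Φ (suc n)) ≡ 0₄ → ∃ λ m → suc n ≡ r ℕ.* 2 ℕ.^ m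
  vanishing⇒ n z = fromDivisor (vanishing⇒order∣ n z)
    where
    fromDivisor : r ∣ⁿ suc n → ∃ λ m → suc n ≡ r ℕ.* 2 ℕ.^ m
    fromDivisor (ℕ∣.divides m@(suc _) sn≡mr) = a , trans eq
        (trans (cong (ℕ._* (r ℕ.* 2 ℕ.^ a)) (vanishing⇒quotient≡1 k a n eq (proj₂ (proj₂ (proj₂ split))) z))
          (ℕ.*-identityˡ (r ℕ.* 2 ℕ.^ a)))
      where
      split = oddPart m
      a = proj₁ split
      k = proj₁ (proj₂ split)

      eq : suc n ≡ k ℕ.* (r ℕ.* 2 ℕ.^ a)
      eq = trans sn≡mr (trans (cong (ℕ._* r) (proj₁ (proj₂ (proj₂ split))))
        (trans (ℕ.*-assoc k (2 ℕ.^ a) r) (cong (k ℕ.*_) (ℕ.*-comm (2 ℕ.^ a) r))))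

  ev-∏Φ≢0 : ∀ P m → (∀ i → suc i ≤ m → P (suc i) ≡ true → ev (Φ (suc i)) ≢ 0₄) → ev (∏Φ P m) ≢ 0₄
  ev-∏Φ≢0 P zero    h e = contradiction (trans (sym ev-1ᴾ) e) λ ()
  ev-∏Φ≢0 P (suc m) h e with *₄-noZeroDivisors _ _ (trans (sym (ev-⊗ (∏Φ P m) (factor P (suc m)))) e)
  ... | inj₁ z = ev-∏Φ≢0 P m (λ i i<m → h i (ℕ.m≤n⇒m≤1+n i<m)) z
  ... | inj₂ z with P (suc m) in Pm
  ... | true  = h m ℕ.≤-refl Pm z
  ... | false = contradiction (trans (sym ev-1ᴾ) z) λ ()

  vanishing⇐ : ∀ m {n} → n ≡ r ℕ.* 2 ℕ.^ m → 2 ≤ n → ev (Φ n) ≡ 0₄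
  vanishing⇐ zero    {n} n≡ 2≤n = subst (λ n → ev (Φ n) ≡ 0₄) (sym n≡r) (base (subst (2 ≤_) n≡r 2≤n))
    where n≡r = trans n≡ (ℕ.*-identityʳ r)
  -- No recursion on m: the quotient for k = 2 vanishes, and `vanishing⇒` shows that its factors
  -- other than Φ n do not.
  vanishing⇐ (suc m) {suc n} n≡ 2≤n = [ id , (λ z → contradiction z coDivisors≢0) ]′
    (*₄-noZeroDivisors (ev (Φ (suc n))) (ev (coDivisors (suc n) g))
      (ev-Φ⊗ 2 g (suc n) {{r*2^-nonZero m}} eq g<n (ℕ∣.m∣m*n (2 ℕ.^ m))))
    where
    g = r ℕ.* 2 ℕ.^ m

    eq : suc n ≡ 2 ℕ.* g
    eq = trans n≡ (trans (sym (ℕ.*-assoc r 2 (2 ℕ.^ m))) (trans (cong (ℕ._* 2 ℕ.^ m) (ℕ.*-comm r 2)) (ℕ.*-assoc 2 r (2 ℕ.^ m))))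

    g<n : g < suc n
    g<n = subst (g <_) (trans (ℕ.*-comm g 2) (sym eq)) (ℕ.m<m*n g 2 {{r*2^-nonZero m}} (s≤s (s≤s z≤n)))

    -- Since suc n is r 2^(m+1), an index r 2^j of at most n has j ≤ m. It therefore divides g and
    -- is absent from `coDivisors`.
    j≤m : ∀ {i j} → suc i ≡ r ℕ.* 2 ℕ.^ j → suc i ≤ n → j ≤ m
    j≤m {i} {j} i≡ i<n = ℕ.≮⇒≥ λ m<j → ℕ.<-irrefl refl (ℕ.<-≤-trans (s≤s i<n)
      (subst₂ _≤_ (sym n≡) (sym i≡) (ℕ.*-monoʳ-≤ r (ℕ.^-monoʳ-≤ 2 m<j))))

    excluded : ∀ i → suc i ≤ n → (∃ λ j → suc i ≡ r ℕ.* 2 ℕ.^ j) → (suc i ∣ᵇ suc n) ∧ not (suc i ∣ᵇ g) ≡ false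
    excluded i i<n (j , i≡) = trans (cong (λ b → (suc i ∣ᵇ suc n) ∧ not b)
      (∣ᵇ-true (subst (_∣ⁿ g) (sym i≡) (ℕ∣.*-monoʳ-∣ r (2^∣2^ {j} (j≤m {j = j} i≡ i<n)))))) (∧-zeroʳ (suc i ∣ᵇ suc n))

    coDivisors≢0 : ev (coDivisors (suc n) g) ≢ 0₄
    coDivisors≢0 = ev-∏Φ≢0 (λ i → (i ∣ᵇ suc n) ∧ not (i ∣ᵇ g)) n λ i i<n Pi z →
      contradiction (trans (sym Pi) (excluded i i<n (vanishing⇒ i z))) λ ()

-- Lucas atoms modulo 2 as values of Φ n.

∣₂⇔Φ-vanishes : ∀ z n ζ w → w ≢ 0₄ → Evaluation₄.ev ζ (Φ n) ≡ w *₄ ι₄ z →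
  (2 ∣ⁿ ℤ.∣ z ∣) ⇔ (Evaluation₄.ev ζ (Φ n) ≡ 0₄)
∣₂⇔Φ-vanishes z n ζ w w≢0 e = mk⇔
  (λ 2∣z → trans e (trans (cong (λ p → w *₄ (p , 0ℙ)) (even⇒parity≡0 2∣z)) (*₄-comm w 0₄)))
  (λ v → [ (λ w≡0 → contradiction w≡0 w≢0) , (λ z≡0 → parity≡0⇒even ℤ.∣ z ∣ (cong proj₁ z≡0)) ]′
    (*₄-noZeroDivisors w (ι₄ z) (trans (sym e) v)))

ev-Φ≡atom : ∀ n γ s t ζ w → IsLucasCoefficients n γ → (∀ j → j ≤ totient n ℕ./ 2 →
    ζ ^₄ j *₄ (1₄ +₄ ζ) ^₄ (totient n ∸ 2 ℕ.* j)
      ≡ w *₄ (ι₄ s ^₄ (totient n ∸ 2 ℕ.* j) *₄ ι₄ (ℤ.- t) ^₄ j)) →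
  Evaluation₄.ev ζ (Φ n) ≡ w *₄ ι₄ (lucasAtom n γ s t)
ev-Φ≡atom n γ s t ζ w lucas same = trans (cong ev (Φ≡cyclotomic n))
  (trans (ev-cong {cyclotomic n} {lucasExpansion n γ} ⟨ lucas ⟩) (ev-lucasExpansion n γ s t w same))
  where open Evaluation₄ ζ

1₄^ : ∀ k → 1₄ ^₄ k ≡ 1₄
1₄^ zero    = refl
1₄^ (suc k) = trans (*₄-identityˡ (1₄ ^₄ k)) (1₄^ k)

^₄≢0 : ∀ {x} → x ≢ 0₄ → ∀ k → x ^₄ k ≢ 0₄
^₄≢0 {x} x≢0 (suc k) e = [ x≢0 , ^₄≢0 x≢0 k ]′ (*₄-noZeroDivisors x (x ^₄ k) e)

-- ω³ = 1 lowers the exponent by three; the exponents 1 and 2 are refuted by computation.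
ω-order : ∀ n → ω ^₄ n ≡ 1₄ → 3 ∣ⁿ n
ω-order zero                e = 3 ℕ∣.∣0
ω-order (suc (suc (suc n))) e = ℕ∣.∣m∣n⇒∣m+n ℕ∣.∣-refl (ω-order n (trans (sym (ω³ (ω ^₄ n))) e))
  where
  ω³ : ∀ x → ω *₄ (ω *₄ (ω *₄ x)) ≡ x
  ω³ = from-yes (every λ x → ω *₄ (ω *₄ (ω *₄ x)) ≟₄ x)

2≰1 : ∀ {A : Set} → 2 ≤ 1 → A
2≰1 (s≤s ())

ev-Φ₃ : Evaluation₄.ev ω (Φ 3) ≡ 0₄
-- `cyclotomic 3` computes to 1 + q + q², and its value at ω to 0.
ev-Φ₃ = cong (Evaluation₄.ev ω) (Φ≡cyclotomic 3)

module At1 = Vanishing 1₄ 1 (λ n _ → ℕ∣.1∣ n) refl 2≰1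
module Atω = Vanishing ω 3 ω-order refl (λ _ → ev-Φ₃)

-- At ζ = 1 in characteristic 2 both 1 + ζ and s are 0, and both ζ and -t are 1, so the terms differ
-- only in the order of their factors.
ev₁-Φ : ∀ n γ → IsLucasCoefficients n γ → Evaluation₄.ev 1₄ (Φ n) ≡ 1₄ *₄ ι₄ (lucasAtom n γ (+ 0) (+ 1))
ev₁-Φ n γ lucas = ev-Φ≡atom n γ (+ 0) (+ 1) 1₄ 1₄ lucas λ j _ →
  trans (*₄-comm (1₄ ^₄ j) (0₄ ^₄ e j)) (sym (*₄-identityˡ (0₄ ^₄ e j *₄ 1₄ ^₄ j)))
  where
  e : ℕ → ℕ
  e j = totient n ∸ 2 ℕ.* j

-- Since 1 + ω = ω² = ω⁻¹, every term ω^j (1 + ω)^(φ - 2j) equals (1 + ω)^φ.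
evω-Φ : ∀ n γ → IsLucasCoefficients n γ →
  Evaluation₄.ev ω (Φ n) ≡ (1₄ +₄ ω) ^₄ totient n *₄ ι₄ (lucasAtom n γ (+ 1) (+ 1))
evω-Φ n γ lucas = ev-Φ≡atom n γ (+ 1) (+ 1) ω ((1₄ +₄ ω) ^₄ totient n) lucas λ j j≤ → begin
  -- (1 + ω)² computes to ω.
  ω ^₄ j *₄ (1₄ +₄ ω) ^₄ e j                            ≡⟨ cong (_*₄ (1₄ +₄ ω) ^₄ e j) (^₄-assocʳ (1₄ +₄ ω) 2 j) ⟩
  (1₄ +₄ ω) ^₄ (2 ℕ.* j) *₄ (1₄ +₄ ω) ^₄ e j            ≡⟨ ^₄-homo-* (1₄ +₄ ω) (2 ℕ.* j) (e j) ⟨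
  (1₄ +₄ ω) ^₄ (2 ℕ.* j ℕ.+ e j)                        ≡⟨ cong ((1₄ +₄ ω) ^₄_) (ℕ.m+[n∸m]≡n (2j≤ j≤)) ⟩
  (1₄ +₄ ω) ^₄ totient n                                ≡⟨ *₄-identityˡ _ ⟨
  1₄ *₄ (1₄ +₄ ω) ^₄ totient n                          ≡⟨ *₄-comm 1₄ ((1₄ +₄ ω) ^₄ totient n) ⟩
  (1₄ +₄ ω) ^₄ totient n *₄ 1₄                          ≡⟨ cong ((1₄ +₄ ω) ^₄ totient n *₄_) (cong₂ _*₄_ (1₄^ (e j)) (1₄^ j)) ⟨
  (1₄ +₄ ω) ^₄ totient n *₄ (1₄ ^₄ e j *₄ 1₄ ^₄ j)      ∎
  where
  open ≡-Reasoning

  e : ℕ → ℕ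
  e j = totient n ∸ 2 ℕ.* j

  2j≤ : ∀ {j} → j ≤ totient n ℕ./ 2 → 2 ℕ.* j ≤ totient n
  2j≤ {j} j≤ = ℕ.≤-trans (ℕ.≤-reflexive (ℕ.*-comm 2 j))
    (ℕ.≤-trans (ℕ.*-monoˡ-≤ 2 j≤) (m/n*n≤m (totient n) 2))

-- Constant coefficients and the values at t = 0.

coeff-1ᴾ : coeff 1ᴾ 0 ≡ + 1
coeff-1ᴾ = cong (λ p → coeff p 0) 1ᴾ≡oneP

coeff-∏Φ : ∀ P m → (∀ i → suc i ≤ m → P (suc i) ≡ true → coeff (Φ (suc i)) 0 ≡ + 1) → coeff (∏Φ P m) 0 ≡ + 1
coeff-∏Φ P zero    h = coeff-1ᴾ
coeff-∏Φ P (suc m) h = trans (coeff-⊗-zero (∏Φ P m) (factor P (suc m)))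
  (cong₂ ℤ._*_ (coeff-∏Φ P m (λ i i<m → h i (ℕ.m≤n⇒m≤1+n i<m))) (last (P (suc m)) refl))
  where
  last : ∀ b → P (suc m) ≡ b → coeff (if b then Φ (suc m) else 1ᴾ) 0 ≡ + 1
  last true  e = h m ℕ.≤-refl e
  last false e = coeff-1ᴾ

coeff-geom : ∀ k → coeff (geom 𝐪 1 (suc k)) 0 ≡ + 1
coeff-geom k = trans (coeff-⊕ 1ᴾ (𝐪 ^ᴾ 1 ⊗ geom 𝐪 1 k) 0) (cong₂ ℤ._+_ coeff-1ᴾ
  (trans (coeff-⊗-zero (𝐪 ^ᴾ 1) (geom 𝐪 1 k)) (trans
    (cong (ℤ._* coeff (geom 𝐪 1 k) 0) (trans (coeff-⊗-zero 𝐪 1ᴾ)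
      (trans (cong (λ p → coeff p 0 ℤ.* coeff 1ᴾ 0) 𝐪≡qP) (ℤ.*-zeroˡ (coeff 1ᴾ 0)))))
    (ℤ.*-zeroˡ (coeff (geom 𝐪 1 k) 0)))))

-- Taking g = 1 removes Φ 1, the one factor with constant coefficient -1: Φ n times the Φ d with 1 <
-- d < n and d dividing n is 1 + q + ... + q^(n-1). Strong induction then applies to the Φ d.
coeff-Φ : ∀ n → coeff (Φ (suc (suc n))) 0 ≡ + 1
coeff-Φ = <-rec (λ n → coeff (Φ (suc (suc n))) 0 ≡ + 1) step
  where
  step : ∀ n → (∀ {m} → m < n → coeff (Φ (suc (suc m))) 0 ≡ + 1) → coeff (Φ (suc (suc n))) 0 ≡ + 1
  step n rec = begin
    coeff (Φ N) 0                                  ≡⟨ ℤ.*-identityʳ _ ⟨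
    coeff (Φ N) 0 ℤ.* + 1                          ≡⟨ cong (coeff (Φ N) 0 ℤ.*_) (coeff-∏Φ _ (suc n) smaller) ⟨
    coeff (Φ N) 0 ℤ.* coeff (coDivisors N 1) 0     ≡⟨ coeff-⊗-zero (Φ N) (coDivisors N 1) ⟨
    coeff (Φ N ⊗ coDivisors N 1) 0                 ≡⟨ at (Φ⊗coDivisors N (X≋∏Φ 0) (X≋∏Φ (suc n)) (sym (ℕ.*-identityʳ N)) (s≤s (s≤s z≤n))) 0 ⟩
    coeff (geom 𝐪 1 N) 0                           ≡⟨ coeff-geom (suc n) ⟩
    + 1                                            ∎
    where
    open ≡-Reasoning
    N = suc (suc n)

    smaller : ∀ i → suc i ≤ suc n → (suc i ∣ᵇ N) ∧ not (suc i ∣ᵇ 1) ≡ true → coeff (Φ (suc i)) 0 ≡ + 1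
    smaller zero    _         e = contradiction (trans (sym e)
      (trans (cong (λ b → (1 ∣ᵇ N) ∧ not b) (∣ᵇ-true {1} {1} ℕ∣.∣-refl)) (∧-zeroʳ (1 ∣ᵇ N)))) λ ()
    smaller (suc i) (s≤s i<n) e = rec i<n

open import Algebra.Properties.Semiring.Exp ℤ.+-*-semiring using () renaming (_^_ to _^ᶻ_)

module Evaluation₀ = Evaluation ℤ.+-*-commutativeRing (λ x → x) refl refl (λ _ _ → refl) (λ _ _ → refl) (+ 0)

ev₀≡coeff : ∀ p → Evaluation₀.ev p ≡ coeff p 0
ev₀≡coeff []      = refl
ev₀≡coeff (x ∷ p) = trans (cong (λ y → x ℤ.+ y) (ℤ.*-zeroˡ (Evaluation₀.ev p))) (ℤ.+-identityʳ x)

-- At q = 0 the expansion has the terms γ_j 0^j 1^(φ - 2j), which are those of P n (1, 0), so the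
-- atom is the constant coefficient of Φ n.
lucasAtom-1-0 : ∀ n γ → 2 ≤ n → IsLucasCoefficients n γ → lucasAtom n γ (+ 1) (+ 0) ≡ + 1
lucasAtom-1-0 n@(suc (suc m)) γ (s≤s (s≤s _)) lucas = begin
  lucasAtom n γ (+ 1) (+ 0)              ≡⟨ ℤ.*-identityˡ _ ⟨
  + 1 ℤ.* lucasAtom n γ (+ 1) (+ 0)      ≡⟨ Evaluation₀.ev-lucasExpansion n γ (+ 1) (+ 0) (+ 1) same ⟨
  Evaluation₀.ev (lucasExpansion n γ)    ≡⟨ ev₀≡coeff (lucasExpansion n γ) ⟩
  coeff (lucasExpansion n γ) 0           ≡⟨ lucas 0 ⟨
  coeff (cyclotomic n) 0                 ≡⟨ cong (λ p → coeff p 0) (Φ≡cyclotomic n) ⟨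
  coeff (Φ n) 0                          ≡⟨ coeff-Φ m ⟩
  + 1                                    ∎
  where
  open ≡-Reasoning
  same : ∀ j → j ≤ totient n ℕ./ 2 → ((+ 0) ^ᶻ j) ℤ.* ((+ 1) ^ᶻ (totient n ∸ 2 ℕ.* j))
    ≡ + 1 ℤ.* (((+ 1) ^ᶻ (totient n ∸ 2 ℕ.* j)) ℤ.* ((+ 0) ^ᶻ j))
  same j _ = trans (ℤ.*-comm ((+ 0) ^ᶻ j) ((+ 1) ^ᶻ (totient n ∸ 2 ℕ.* j)))
    (sym (ℤ.*-identityˡ (((+ 1) ^ᶻ (totient n ∸ 2 ℕ.* j)) ℤ.* ((+ 0) ^ᶻ j))))

-- The first candidate, 1, is coprime to every number.
totient-suc : ∀ n → ∃ λ k → totient (suc n) ≡ suc k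
totient-suc n = _ , cong length (List.filter-accept (λ k → gcd k (suc n) ℕ.≟ 1) {1} {List.map suc (List.applyUpTo suc n)} (gcd-zeroˡ (suc n)))

-- For j > 0 the power of -t vanishes; for j = 0 the power of s does, because φ(n) > 0 rules out
-- 0^0.
lucasAtom-0-0 : ∀ n γ → lucasAtom (suc n) γ (+ 0) (+ 0) ≡ + 0
lucasAtom-0-0 n γ = zeros (List.upTo (totient (suc n) ℕ./ 2 ℕ.+ 1))
  where
  zero-^ : ∀ {k} → (∃ λ m → k ≡ suc m) → (+ 0) ℤ.^ k ≡ + 0
  zero-^ (m , refl) = ℤ.*-zeroˡ ((+ 0) ℤ.^ m)

  term : ∀ j → γ j ℤ.* ((+ 0) ℤ.^ (totient (suc n) ∸ 2 ℕ.* j)) ℤ.* ((+ 0) ℤ.^ j) ≡ + 0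
  term zero    = trans (ℤ.*-identityʳ _) (trans (cong (γ 0 ℤ.*_) (zero-^ (totient-suc n))) (ℤ.*-zeroʳ (γ 0)))
  term (suc j) = trans (cong (γ (suc j) ℤ.* ((+ 0) ℤ.^ (totient (suc n) ∸ 2 ℕ.* suc j)) ℤ.*_) (zero-^ (j , refl)))
    (ℤ.*-zeroʳ (γ (suc j) ℤ.* ((+ 0) ℤ.^ (totient (suc n) ∸ 2 ℕ.* suc j))))

  zeros : ∀ js → List.foldr ℤ._+_ (+ 0)
    (List.map (λ j → γ j ℤ.* ((+ 0) ℤ.^ (totient (suc n) ∸ 2 ℕ.* j)) ℤ.* ((+ 0) ℤ.^ j)) js) ≡ + 0
  zeros []       = refl
  zeros (j ∷ js) = cong₂ ℤ._+_ (term j) (zeros js)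

open import Data.Nat using (_*_; _^_)
open import Data.Integer.Divisibility using (_∣_)
open import Data.Product using (∃-syntax)

theorem6p3 : (n : ℕ) → 2 ≤ n → (γ : ℕ → ℤ) → IsLucasCoefficients n γ →
    (lucasAtom n γ (+ 0) (+ 0) ≡ + 0)
    × (lucasAtom n γ (+ 1) (+ 0) ≡ + 1)
    × ((+ 2 ∣ lucasAtom n γ (+ 0) (+ 1)) ⇔ (∃[ m ] (1 ≤ m × n ≡ 2 ^ m)))
    × ((+ 2 ∣ lucasAtom n γ (+ 1) (+ 1)) ⇔ (∃[ m ] (n ≡ 3 * 2 ^ m)))
theorem6p3 n@(suc n′) 2≤n γ lucas =
    lucasAtom-0-0 n′ γ
  , lucasAtom-1-0 n γ 2≤n lucas
  , mk⇔ (λ 2∣ → power (At1.vanishing⇒ n′ (to at1 2∣)))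
        (λ (m , _ , n≡) → from at1 (At1.vanishing⇐ m (trans n≡ (sym (ℕ.*-identityˡ (2 ^ m)))) 2≤n))
  , mk⇔ (λ 2∣ → Atω.vanishing⇒ n′ (to atω 2∣))
        (λ (m , n≡) → from atω (Atω.vanishing⇐ m n≡ 2≤n))
  where
  open Equivalence
  at1 = ∣₂⇔Φ-vanishes (lucasAtom n γ (+ 0) (+ 1)) n 1₄ 1₄ (λ ()) (ev₁-Φ n γ lucas)
  atω = ∣₂⇔Φ-vanishes (lucasAtom n γ (+ 1) (+ 1)) n ω ((1₄ +₄ ω) ^₄ totient n) (^₄≢0 (λ ()) (totient n)) (evω-Φ n γ lucas)

  power : (∃ λ m → n ≡ 1 * 2 ^ m) → ∃[ m ] (1 ≤ m × n ≡ 2 ^ m)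
  -- m = 0 would mean n = 1; excluding it yields `1 ≤ m`.
  power (zero  , n≡) = contradiction (subst (2 ≤_) n≡ 2≤n) λ { (s≤s ()) }
  power (suc m , n≡) = suc m , s≤s z≤n , trans n≡ (ℕ.*-identityˡ (2 ^ suc m))
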